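{- Let $\mathcal{D}$ be a model for the formal mathematical system $[M;\mathcal{L}]$, and let $[\hat M;\hat{\mathcal{L}}]$ be the extension of $[M;\mathcal{L}]$ by the names of the individuals of $\mathcal{D}$. Then for every formula $F$ in $[\hat M;\hat{\mathcal{L}}]$: $$F\in\Pi(\hat M;\hat{\mathcal{L}})\ \Rightarrow\ F\text{ is valid in }\mathcal{D},$$ where $\Pi(\hat M;\hat{\mathcal{L}})$ denotes the set of provable formulas in $[\hat M;\hat{\mathcal{L}}]$.
   Context: **Syntax.** $X=\{\mathbf{x}_1,\mathbf{x}_2,\ldots\}$ is the countably infinite alphabet of variables. Let $A$ be a set of constant/operation symbols and $P$ a set of predicate symbols. $A$-lists are the strings generated by: every $x\in X$ and every $a\in A$ is an $A$-list; if $\lambda$ is an $A$-list and $f\in A$ then $f(\lambda)$ is an $A$-list; if $\lambda,\mu$ are $A$-lists then the concatenation $\lambda\mu$ is an $A$-list. $\mathrm{var}(\lambda)$ is the set of variables occurring in $\lambda$; $\lambda\frac{\mu}{x}$ is the list obtained by replacing $x$ everywhere in $\lambda$ by $\mu$. Formulas are written in prefix notation. Prime formulas are $\sim\lambda,\mu$ (equality), $p$, and $p\,\lambda_1,\ldots,\lambda_n$ for $p\in P$, $n\ge1$ and argument lists $\lambda,\mu,\lambda_i$ (a predicate symbol may be used with any number of arguments). If $F,G$ are formulas and $x\in X$, then $\neg F$, $\to FG$, $\leftrightarrow FG$, $\&FG$, $\vee FG$, $\forall xF$, $\exists xF$ are formulas. $\mathrm{free}(F)$ is the set of variables occurring free in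 $F$; $F$ is closed if $\mathrm{free}(F)=\emptyset$. $F\frac{\lambda}{x}=\mathrm{SbF}(F;\lambda;x)$ is the result of replacing every free occurrence of $x$ in $F$ by $\lambda$. The condition $\mathrm{CF}(F;\lambda;x)$ says that this substitution is collision-free: no free occurrence of $x$ in $F$ lies in the scope of a quantifier $\forall y$ or $\exists y$ with $y\in\mathrm{var}(\lambda)$. **Formal mathematical systems.** $[M;\mathcal{L}]$ with $M=[A;P;B]$ consists of $A$, $P$, a set $\mathcal{L}$ of $A$-lists with $X\subseteq\mathcal{L}$ and $\lambda\frac{\mu}{x}\in\mathcal{L}$ for all $\lambda,\mu\in\mathcal{L}$, $x\in X$, and a set $B$ of formulas (basis axioms) with all argument lists in $\mathcal{L}$. Formulas of $[M;\mathcal{L}]$ are the formulas over $A,P$ all of whose argument lists are in $\mathcal{L}$. $\Pi(M;\mathcal{L})$ is the set of formulas of $[M;\mathcal{L}]$ provable by the following Hilbert-style calculus, in which all formulas have argument lists in $\mathcal{L}$. Axioms: the formulas in $B$; all $\alpha(F_1,\ldots,F_j)$ for propositional tautologies $\alpha$; equality axioms $\sim x,x$; $\to\mathrm{SbF}(\sim\lambda,\mu;x;y)\to\sim x,y\,\sim\lambda,\mu$ ($x,y\in X$, $\lambda,\mu\in\mathcal{L}$); $\to\sim x_1,y_1\ldots\to\sim x_n,y_n\to p\,x_1,\ldots,x_n\;p\,y_1,\ldots,y_n$ ($p\in P$, $n\ge1$, $x_i,y_i\in X$); quantifier axioms $\to\forall xF\,F$; $\to\forall x\to FG\;\to F\,\forall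 xG$ if $x\notin\mathrm{free}(F)$; $\leftrightarrow\neg\forall x\neg F\;\exists xF$. Rules: (a) axioms may be written down; (b) from $F$ and $\to FG$ infer $G$; (c) from $F$ infer $F\frac{\lambda}{x}$ if $x\in X$, $\lambda\in\mathcal{L}$ and $\mathrm{CF}(F;\lambda;x)$; (d) from $F$ infer $\forall xF$. **Models.** A model $\mathcal{D}$ of $[M;\mathcal{L}]$ consists of: (1) a nonempty set $\mathcal{D}_*$ (universe; its members are individuals); (2) for each $d\in\mathcal{D}_*$ exactly one name $\alpha_d$, with different individuals having different names; $\mathcal{N}=\{\alpha_d:d\in\mathcal{D}_*\}$ consists of symbols different from those of $[M;\mathcal{L}]$; (3) the extended system $[\hat M;\hat{\mathcal{L}}]$ with $\hat A=A\cup\mathcal{N}$, $\hat M=[\hat A;P;B]$, $\hat{\mathcal{L}}=\{\lambda\frac{\kappa_1}{x_1}\ldots\frac{\kappa_m}{x_m}:\lambda\in\mathcal{L},x_i\in X,\kappa_i\in\mathcal{N},m\ge0\}$; $\hat{\mathcal{L}}_*$ is the set of $\lambda\in\hat{\mathcal{L}}$ with $\mathrm{var}(\lambda)=\emptyset$; (4) a surjective function $\mathcal{D}:\hat{\mathcal{L}}_*\to\mathcal{D}_*$ with $\mathcal{D}(\lambda\frac{\mu}{x})=\mathcal{D}(\lambda\frac{\alpha_{\mathcal{D}(\mu)}}{x})$ for all $\mu\in\hat{\mathcal{L}}_*$, $x\in X$, $\lambda\in\hat{\mathcal{L}}$ with $\mathrm{var}(\lambda)\subseteq\{x\}$; (5)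 for each $p\in P$ and $n\in\mathbb{N}_0$ an $n$-ary predicate $p_n\subseteq\mathcal{D}_*^n$, where for $n=0$, $p_0\in\{\top,\bot\}$ is a truth value; (6) an extension of $\mathcal{D}$ assigning a truth value to each closed formula of $[\hat M;\hat{\mathcal{L}}]$: $\mathcal{D}(\sim\lambda,\mu)=\top$ iff $\mathcal{D}(\lambda)=\mathcal{D}(\mu)$; $\mathcal{D}(p)=p_0$; $\mathcal{D}(p\,\lambda_1,\ldots,\lambda_n)=\top$ iff $(\mathcal{D}(\lambda_1),\ldots,\mathcal{D}(\lambda_n))\in p_n$; the connectives $\neg,\to,\leftrightarrow,\&,\vee$ are interpreted classically; for $\mathrm{free}(F)\subseteq\{x\}$, $\mathcal{D}(\forall xF)=\top$ iff $\mathcal{D}(F\frac{\lambda}{x})=\top$ for all $\lambda\in\hat{\mathcal{L}}_*$, and $\mathcal{D}(\exists xF)=\top$ iff $\mathcal{D}(F\frac{\lambda}{x})=\top$ for some $\lambda\in\hat{\mathcal{L}}_*$; (7) a formula $F$ of $[\hat M;\hat{\mathcal{L}}]$ with $\mathrm{free}(F)=\{x_1,\ldots,x_m\}$ is called valid in $\mathcal{D}$ iff $\mathcal{D}(F\frac{\lambda_1}{x_1}\ldots\frac{\lambda_m}{x_m})=\top$ for all $\lambda_1,\ldots,\lambda_m\in\hat{\mathcal{L}}_*$; (8) every $F\in B$ is valid in $\mathcal{D}$. -}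

module Defs where

open import Level using (Level; suc)
open import Data.Bool.Base using (Bool; true; false; not; _∧_; _∨_; _xor_)
open import Data.Empty using (⊥; ⊥-elim)
open import Data.Fin.Base using (Fin)
open import Data.List.Base using (List; []; _∷_; _++_; map; concatMap; filter)
open import Data.List.Extrema.Nat using (max; xs≤max)
open import Data.List.Membership.Propositional using (_∈_; _∉_)
open import Data.List.Membership.Propositional.Properties
  using (∈-++⁺ˡ; ∈-++⁺ʳ; ∈-++⁻; ∈-filter⁺; ∈-filter⁻)
open import Data.List.Relation.Unary.All as All using (All; []; _∷_)
open import Data.List.Relation.Unary.All.Properties using (++⁺; All¬⇒¬Any)
open import Data.List.Relation.Unary.Any using (here; there)
open import Data.List.Relation.Binary.Subset.Propositional using (_⊆_)
open import Data.List.Relation.Binary.Subset.Propositional.Properties using (⊆[]⇒≡[])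
open import Data.Nat.Base as ℕ using (ℕ)
open import Data.Nat.Properties using (_≟_; <-irrefl)
open import Data.Product.Base using (Σ; ∃; ∃₂; _×_; _,_; proj₁; proj₂; map₂)
open import Data.Sum.Base as Sum using (_⊎_; inj₁; inj₂; [_,_]′)
open import Data.Vec.Base as Vec using (Vec; []; _∷_; toList)
open import Data.Vec.Relation.Unary.All as VecAll using ([]; _∷_)
open import Function.Base using (_∘_)
open import Function.Bundles using (_⇔_)
open import Function.Definitions using (Bijective)
open import Relation.Binary.PropositionalEquality
  using (_≡_; _≢_; refl; sym; trans; cong; cong₂; subst)
open import Relation.Nullary using (¬_; yes; no)
open import Relation.Nullary.Decidable using (¬?)
open import Relation.Unary using (Pred)

private
  variable
    ℓ : Level
    A A′ P N : Set ℓ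

------------------------------------------------------------------------
-- Syntax

-- The variable 𝐱ᵢ is represented by its index.
Var : Set
Var = ℕ

-- Lists are nonempty sequences of items x, a or f(λ). Concatenation of
-- strings is associative, so it is an operation and not a constructor:
-- each string then has exactly one representation.
mutual
  data Item (A : Set ℓ) : Set ℓ where
    var : Var → Item A
    con : A → Item A
    app : A → AList A → Item A

  data AList (A : Set ℓ) : Set ℓ where
    ⌊_⌋ : Item A → AList A
    _◃_ : Item A → AList A → AList A

infixr 5 _◃_ _⌢_

_⌢_ : AList A → AList A → AList A
⌊ i ⌋ ⌢ μ = i ◃ μ
(i ◃ l) ⌢ μ = i ◃ (l ⌢ μ)

mutual
  varsᵢ : Item A → List Var
  varsᵢ (var x) = x ∷ []
  varsᵢ (con a) = []
  varsᵢ (app f l) = vars l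

  vars : AList A → List Var
  vars ⌊ i ⌋ = varsᵢ i
  vars (i ◃ l) = varsᵢ i ++ vars l

infixl 30 _[_/_]ᵢ _[_/_] _[_]* _[_/_]ᶠ _[_]ᶠ*

mutual
  _[_/_]ᵢ : Item A → AList A → Var → AList A
  var y [ μ / x ]ᵢ with x ≟ y
  ... | yes _ = μ
  ... | no _ = ⌊ var y ⌋
  con a [ μ / x ]ᵢ = ⌊ con a ⌋
  app f l [ μ / x ]ᵢ = ⌊ app f (l [ μ / x ]) ⌋

  _[_/_] : AList A → AList A → Var → AList A
  ⌊ i ⌋ [ μ / x ] = i [ μ / x ]ᵢ
  (i ◃ l) [ μ / x ] = (i [ μ / x ]ᵢ) ⌢ (l [ μ / x ])

-- Successive (not simultaneous) substitution, first pair first.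
_[_]* : AList A → List (Var × AList A) → AList A
l [ [] ]* = l
l [ (x , μ) ∷ σ ]* = l [ μ / x ] [ σ ]*

mutual
  embedᵢ : (A → A′) → Item A → Item A′
  embedᵢ g (var x) = var x
  embedᵢ g (con a) = con (g a)
  embedᵢ g (app f l) = app (g f) (embed g l)

  embed : (A → A′) → AList A → AList A′
  embed g ⌊ i ⌋ = ⌊ embedᵢ g i ⌋
  embed g (i ◃ l) = embedᵢ g i ◃ embed g l

data Connective : Set where
  →′ ↔′ &′ ∨′ : Connective

data Quantifier : Set where
  ∀′ ∃′ : Quantifier

infix 20 _≐_

-- atom p λs with an empty vector is the prime formula p.
data Formula (A P : Set ℓ) : Set ℓ where
  _≐_ : AList A → AList A → Formula A P
  atom : P → {n : ℕ} → Vec (AList A) n → Formula A P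
  neg : Formula A P → Formula A P
  binary : Connective → Formula A P → Formula A P → Formula A P
  quant : Quantifier → Var → Formula A P → Formula A P

infixr 10 _⇒_

pattern _⇒_ F G = binary →′ F G
pattern _⟺_ F G = binary ↔′ F G
pattern all x F = quant ∀′ x F
pattern ex x F = quant ∃′ x F

free : Formula A P → List Var
free (l ≐ μ) = vars l ++ vars μ
free (atom p ls) = concatMap vars (toList ls)
free (neg F) = free F
free (binary c F G) = free F ++ free G
free (quant q x F) = filter (λ y → ¬? (x ≟ y)) (free F)

-- F [ λ / x ]ᶠ is F with every free x replaced by λ, also if variables
-- of λ become bound; see CollisionFree.
_[_/_]ᶠ : Formula A P → AList A → Var → Formula A P
(l ≐ μ) [ ν / x ]ᶠ = (l [ ν / x ]) ≐ (μ [ ν / x ])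
atom p ls [ ν / x ]ᶠ = atom p (Vec.map (_[ ν / x ]) ls)
neg F [ ν / x ]ᶠ = neg (F [ ν / x ]ᶠ)
binary c F G [ ν / x ]ᶠ = binary c (F [ ν / x ]ᶠ) (G [ ν / x ]ᶠ)
quant q y F [ ν / x ]ᶠ with x ≟ y
... | yes _ = quant q y F
... | no _ = quant q y (F [ ν / x ]ᶠ)

_[_]ᶠ* : Formula A P → List (Var × AList A) → Formula A P
F [ [] ]ᶠ* = F
F [ (x , μ) ∷ σ ]ᶠ* = F [ μ / x ]ᶠ [ σ ]ᶠ*

-- Some free occurrence of x in the formula lies in the scope of a
-- quantifier on y.
FreeInScopeOf : Var → Var → Formula A P → Set
FreeInScopeOf x y (l ≐ μ) = ⊥
FreeInScopeOf x y (atom p ls) = ⊥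
FreeInScopeOf x y (neg F) = FreeInScopeOf x y F
FreeInScopeOf x y (binary c F G) = FreeInScopeOf x y F ⊎ FreeInScopeOf x y G
FreeInScopeOf x y (quant q z F) =
  x ≢ z × ((y ≡ z × x ∈ free F) ⊎ FreeInScopeOf x y F)

CollisionFree : Formula A P → AList A → Var → Set
CollisionFree F l x = ∀ y → y ∈ vars l → ¬ FreeInScopeOf x y F

ListsIn : {A P : Set ℓ} → Pred (AList A) ℓ → Pred (Formula A P) ℓ
ListsIn 𝓛 (l ≐ μ) = 𝓛 l × 𝓛 μ
ListsIn 𝓛 (atom p ls) = VecAll.All 𝓛 ls
ListsIn 𝓛 (neg F) = ListsIn 𝓛 F
ListsIn 𝓛 (binary c F G) = ListsIn 𝓛 F × ListsIn 𝓛 G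
ListsIn 𝓛 (quant q x F) = ListsIn 𝓛 F

embedᶠ : (A → A′) → Formula A P → Formula A′ P
embedᶠ g (l ≐ μ) = embed g l ≐ embed g μ
embedᶠ g (atom p ls) = atom p (Vec.map (embed g) ls)
embedᶠ g (neg F) = neg (embedᶠ g F)
embedᶠ g (binary c F G) = binary c (embedᶠ g F) (embedᶠ g G)
embedᶠ g (quant q x F) = quant q x (embedᶠ g F)

------------------------------------------------------------------------
-- Tautologies

-- Truth values are Booleans: every metatheoretic "truth value ⊤ or ⊥"
-- is two-valued.
⟦_⟧ᶜ : Connective → Bool → Bool → Bool
⟦ →′ ⟧ᶜ a b = not a ∨ b
⟦ ↔′ ⟧ᶜ a b = not (a xor b)
⟦ &′ ⟧ᶜ a b = a ∧ b
⟦ ∨′ ⟧ᶜ a b = a ∨ b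

data PropFormula (j : ℕ) : Set where
  pvar : Fin j → PropFormula j
  pneg : PropFormula j → PropFormula j
  pbinary : Connective → PropFormula j → PropFormula j → PropFormula j

⟦_⟧ᵖ : {j : ℕ} → PropFormula j → (Fin j → Bool) → Bool
⟦ pvar i ⟧ᵖ v = v i
⟦ pneg α ⟧ᵖ v = not (⟦ α ⟧ᵖ v)
⟦ pbinary c α β ⟧ᵖ v = ⟦ c ⟧ᶜ (⟦ α ⟧ᵖ v) (⟦ β ⟧ᵖ v)

Tautology : {j : ℕ} → PropFormula j → Set
Tautology α = ∀ v → ⟦ α ⟧ᵖ v ≡ true

_⟨_⟩ᵖ : {j : ℕ} → PropFormula j → (Fin j → Formula A P) → Formula A P
pvar i ⟨ Fs ⟩ᵖ = Fs i
pneg α ⟨ Fs ⟩ᵖ = neg (α ⟨ Fs ⟩ᵖ)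
pbinary c α β ⟨ Fs ⟩ᵖ = binary c (α ⟨ Fs ⟩ᵖ) (β ⟨ Fs ⟩ᵖ)

------------------------------------------------------------------------
-- Formal mathematical systems

record FormalSystem (A P : Set ℓ) : Set (suc ℓ) where
  field
    𝓛 : Pred (AList A) ℓ
    X⊆𝓛 : ∀ x → 𝓛 ⌊ var x ⌋
    𝓛-subst : ∀ {l μ} x → 𝓛 l → 𝓛 μ → 𝓛 (l [ μ / x ])
    B : Pred (Formula A P) ℓ
    B-lists : ∀ {F} → B F → ListsIn 𝓛 F

  IsFormula : Pred (Formula A P) ℓ
  IsFormula = ListsIn 𝓛

-- → ∼x₁,y₁ … → ∼xₙ,yₙ F
equalities⇒ : {n : ℕ} → Vec Var n → Vec Var n → Formula A P → Formula A P
equalities⇒ [] [] F = F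
equalities⇒ (x ∷ xs) (y ∷ ys) F =
  (⌊ var x ⌋ ≐ ⌊ var y ⌋) ⇒ equalities⇒ xs ys F

varArgs : {n : ℕ} → Vec Var n → Vec (AList A) n
varArgs = Vec.map (λ x → ⌊ var x ⌋)

module _ {A P : Set ℓ} (S : FormalSystem A P) where
  open FormalSystem S

  data Provable : Formula A P → Set ℓ where
    basis : ∀ {F} → B F → Provable F
    tautology : ∀ {j} (α : PropFormula j) (Fs : Fin j → Formula A P) →
      Tautology α → (∀ i → IsFormula (Fs i)) → Provable (α ⟨ Fs ⟩ᵖ)
    ≐-refl : ∀ x → Provable (⌊ var x ⌋ ≐ ⌊ var x ⌋)
    -- SbF(∼λ,μ;x;y) puts x for y.
    ≐-subst : ∀ x y {l μ} → 𝓛 l → 𝓛 μ →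
      Provable ((l ≐ μ) [ ⌊ var x ⌋ / y ]ᶠ ⇒
                (⌊ var x ⌋ ≐ ⌊ var y ⌋) ⇒ (l ≐ μ))
    ≐-atom : ∀ (p : P) {n} (xs ys : Vec Var (ℕ.suc n)) →
      Provable (equalities⇒ xs ys
                 (atom p (varArgs xs) ⇒ atom p (varArgs ys)))
    ∀-elim : ∀ x {F} → IsFormula F → Provable (all x F ⇒ F)
    ∀-shift : ∀ x {F G} → IsFormula F → IsFormula G → x ∉ free F →
      Provable (all x (F ⇒ G) ⇒ F ⇒ all x G)
    ∃-def : ∀ x {F} → IsFormula F →
      Provable (neg (all x (neg F)) ⟺ ex x F)
    detach : ∀ {F G} → Provable F → Provable (F ⇒ G) → Provable G
    substitute : ∀ {F l} x → Provable F → 𝓛 l → CollisionFree F l x →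
      Provable (F [ l / x ]ᶠ)
    generalize : ∀ {F} x → Provable F → Provable (all x F)

------------------------------------------------------------------------
-- Properties of substitution

private
  ⌢-assoc : (k l m : AList A) → (k ⌢ l) ⌢ m ≡ k ⌢ (l ⌢ m)
  ⌢-assoc ⌊ i ⌋ l m = refl
  ⌢-assoc (i ◃ k) l m = cong (i ◃_) (⌢-assoc k l m)

  ⌢-subst : (k l μ : AList A) (x : Var) →
    (k ⌢ l) [ μ / x ] ≡ k [ μ / x ] ⌢ l [ μ / x ]
  ⌢-subst ⌊ i ⌋ l μ x = refl
  ⌢-subst (i ◃ k) l μ x =
    trans (cong (i [ μ / x ]ᵢ ⌢_) (⌢-subst k l μ x))
          (sym (⌢-assoc (i [ μ / x ]ᵢ) (k [ μ / x ]) (l [ μ / x ])))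

  ⌢-embed : (g : A → A′) (k l : AList A) →
    embed g (k ⌢ l) ≡ embed g k ⌢ embed g l
  ⌢-embed g ⌊ i ⌋ l = refl
  ⌢-embed g (i ◃ k) l = cong (embedᵢ g i ◃_) (⌢-embed g k l)

  ∈-vars-⌢ : (k l : AList A) {z : Var} →
    z ∈ vars (k ⌢ l) → z ∈ vars k ⊎ z ∈ vars l
  ∈-vars-⌢ ⌊ i ⌋ l z∈ = ∈-++⁻ (varsᵢ i) z∈
  ∈-vars-⌢ (i ◃ k) l z∈ with ∈-++⁻ (varsᵢ i) z∈
  ... | inj₁ z∈i = inj₁ (∈-++⁺ˡ z∈i)
  ... | inj₂ z∈kl = Sum.map₁ (∈-++⁺ʳ (varsᵢ i)) (∈-vars-⌢ k l z∈kl)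

  mutual
    embedᵢ-subst : (g : A → A′) (i : Item A) (μ : AList A) (x : Var) →
      embed g (i [ μ / x ]ᵢ) ≡ embedᵢ g i [ embed g μ / x ]ᵢ
    embedᵢ-subst g (var y) μ x with x ≟ y
    ... | yes _ = refl
    ... | no _ = refl
    embedᵢ-subst g (con a) μ x = refl
    embedᵢ-subst g (app f l) μ x =
      cong (⌊_⌋ ∘ app (g f)) (embed-subst g l μ x)

    embed-subst : (g : A → A′) (l μ : AList A) (x : Var) →
      embed g (l [ μ / x ]) ≡ embed g l [ embed g μ / x ]
    embed-subst g ⌊ i ⌋ μ x = embedᵢ-subst g i μ x
    embed-subst g (i ◃ l) μ x =
      trans (⌢-embed g (i [ μ / x ]ᵢ) (l [ μ / x ]))
            (cong₂ _⌢_ (embedᵢ-subst g i μ x) (embed-subst g l μ x))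

  mutual
    varsᵢ-embed : (g : A → A′) (i : Item A) → varsᵢ (embedᵢ g i) ≡ varsᵢ i
    varsᵢ-embed g (var x) = refl
    varsᵢ-embed g (con a) = refl
    varsᵢ-embed g (app f l) = vars-embed g l

    vars-embed : (g : A → A′) (l : AList A) → vars (embed g l) ≡ vars l
    vars-embed g ⌊ i ⌋ = varsᵢ-embed g i
    vars-embed g (i ◃ l) = cong₂ _++_ (varsᵢ-embed g i) (vars-embed g l)

  mutual
    substᵢ-fresh : (i : Item A) (μ : AList A) {x : Var} →
      x ∉ varsᵢ i → i [ μ / x ]ᵢ ≡ ⌊ i ⌋
    substᵢ-fresh (var y) μ {x} x∉ with x ≟ y
    ... | yes x≡y = ⊥-elim (x∉ (here x≡y))
    ... | no _ = refl
    substᵢ-fresh (con a) μ x∉ = refl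
    substᵢ-fresh (app f l) μ x∉ = cong (⌊_⌋ ∘ app f) (subst-fresh l μ x∉)

    subst-fresh : (l μ : AList A) {x : Var} → x ∉ vars l → l [ μ / x ] ≡ l
    subst-fresh ⌊ i ⌋ μ x∉ = substᵢ-fresh i μ x∉
    subst-fresh (i ◃ l) μ x∉ =
      cong₂ _⌢_ (substᵢ-fresh i μ (x∉ ∘ ∈-++⁺ˡ))
                (subst-fresh l μ (x∉ ∘ ∈-++⁺ʳ (varsᵢ i)))

  subst-var : (μ : AList A) (x : Var) → ⌊ var x ⌋ [ μ / x ] ≡ μ
  subst-var μ x with x ≟ x
  ... | yes _ = refl
  ... | no x≢x = ⊥-elim (x≢x refl)

  mutual
    substᵢ-comm : (i : Item A) (μ ν : AList A) {x z : Var} →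
      x ≢ z → x ∉ vars ν →
      i [ μ / x ]ᵢ [ ν / z ] ≡ i [ ν / z ]ᵢ [ μ [ ν / z ] / x ]
    substᵢ-comm (var y) μ ν {x} {z} x≢z x∉ν with z ≟ y
    ... | yes refl =
      trans (cong (_[ ν / z ]) (substᵢ-fresh (var z) μ
              (λ { (here x≡z) → x≢z x≡z })))
            (trans (subst-var ν z) (sym (subst-fresh ν (μ [ ν / z ]) x∉ν)))
    ... | no z≢y with x ≟ y
    ... | yes _ = refl
    ... | no _ = substᵢ-fresh (var y) ν (λ { (here z≡y) → z≢y z≡y })
    substᵢ-comm (con a) μ ν x≢z x∉ν = refl
    substᵢ-comm (app f l) μ ν x≢z x∉ν =
      cong (⌊_⌋ ∘ app f) (subst-comm l μ ν x≢z x∉ν)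

    subst-comm : (l μ ν : AList A) {x z : Var} → x ≢ z → x ∉ vars ν →
      l [ μ / x ] [ ν / z ] ≡ l [ ν / z ] [ μ [ ν / z ] / x ]
    subst-comm ⌊ i ⌋ μ ν x≢z x∉ν = substᵢ-comm i μ ν x≢z x∉ν
    subst-comm (i ◃ l) μ ν {x} {z} x≢z x∉ν =
      trans (⌢-subst (i [ μ / x ]ᵢ) (l [ μ / x ]) ν z)
        (trans (cong₂ _⌢_ (substᵢ-comm i μ ν x≢z x∉ν)
                          (subst-comm l μ ν x≢z x∉ν))
          (sym (⌢-subst (i [ ν / z ]ᵢ) (l [ ν / z ]) (μ [ ν / z ]) x)))

  mutual
    ∈-varsᵢ-subst : (i : Item A) (μ : AList A) (x : Var) {z : Var} →
      z ∈ vars (i [ μ / x ]ᵢ) → (z ∈ varsᵢ i × x ≢ z) ⊎ z ∈ vars μ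
    ∈-varsᵢ-subst (var y) μ x z∈ with x ≟ y
    ... | yes _ = inj₂ z∈
    ... | no x≢y = inj₁ (z∈ , λ { refl → x≢y (∈[y] z∈) })
      where
      ∈[y] : ∀ {z} → z ∈ y ∷ [] → z ≡ y
      ∈[y] (here eq) = eq
    ∈-varsᵢ-subst (con a) μ x ()
    ∈-varsᵢ-subst (app f l) μ x z∈ = ∈-vars-subst l μ x z∈

    ∈-vars-subst : (l μ : AList A) (x : Var) {z : Var} →
      z ∈ vars (l [ μ / x ]) → (z ∈ vars l × x ≢ z) ⊎ z ∈ vars μ
    ∈-vars-subst ⌊ i ⌋ μ x z∈ = ∈-varsᵢ-subst i μ x z∈
    ∈-vars-subst (i ◃ l) μ x z∈ with ∈-vars-⌢ (i [ μ / x ]ᵢ) (l [ μ / x ]) z∈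
    ... | inj₁ z∈i =
      Sum.map₁ (λ (p , q) → ∈-++⁺ˡ p , q) (∈-varsᵢ-subst i μ x z∈i)
    ... | inj₂ z∈l =
      Sum.map₁ (λ (p , q) → ∈-++⁺ʳ (varsᵢ i) p , q) (∈-vars-subst l μ x z∈l)

  ∈-free-args : ∀ {n} (ls : Vec (AList A) n) (μ : AList A) (x : Var) {z : Var} →
    z ∈ concatMap vars (toList (Vec.map (_[ μ / x ]) ls)) →
    (z ∈ concatMap vars (toList ls) × x ≢ z) ⊎ z ∈ vars μ
  ∈-free-args [] μ x ()
  ∈-free-args (l ∷ ls) μ x z∈ with ∈-++⁻ (vars (l [ μ / x ])) z∈
  ... | inj₁ z∈l = Sum.map₁ (λ (p , q) → ∈-++⁺ˡ p , q) (∈-vars-subst l μ x z∈l)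
  ... | inj₂ z∈ls =
    Sum.map₁ (λ (p , q) → ∈-++⁺ʳ (vars l) p , q) (∈-free-args ls μ x z∈ls)

  ∈-free-subst : (F : Formula A P) (μ : AList A) (x : Var) {z : Var} →
    z ∈ free (F [ μ / x ]ᶠ) → (z ∈ free F × x ≢ z) ⊎ z ∈ vars μ
  ∈-free-subst (k ≐ l) μ x z∈ with ∈-++⁻ (vars (k [ μ / x ])) z∈
  ... | inj₁ z∈k = Sum.map₁ (λ (p , q) → ∈-++⁺ˡ p , q) (∈-vars-subst k μ x z∈k)
  ... | inj₂ z∈l =
    Sum.map₁ (λ (p , q) → ∈-++⁺ʳ (vars k) p , q) (∈-vars-subst l μ x z∈l)
  ∈-free-subst (atom p ls) μ x z∈ = ∈-free-args ls μ x z∈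
  ∈-free-subst (neg F) μ x z∈ = ∈-free-subst F μ x z∈
  ∈-free-subst (binary c F G) μ x z∈ with ∈-++⁻ (free (F [ μ / x ]ᶠ)) z∈
  ... | inj₁ z∈F = Sum.map₁ (λ (p , q) → ∈-++⁺ˡ p , q) (∈-free-subst F μ x z∈F)
  ... | inj₂ z∈G =
    Sum.map₁ (λ (p , q) → ∈-++⁺ʳ (free F) p , q) (∈-free-subst G μ x z∈G)
  ∈-free-subst (quant q y F) μ x z∈ with x ≟ y
  ... | yes refl =
    inj₁ (z∈ , proj₂ (∈-filter⁻ (λ w → ¬? (y ≟ w)) {xs = free F} z∈))
  ... | no _ with ∈-filter⁻ (λ w → ¬? (y ≟ w)) {xs = free (F [ μ / x ]ᶠ)} z∈
  ... | z∈F , y≢z =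
    Sum.map₁ (λ (p , q) → ∈-filter⁺ (λ w → ¬? (y ≟ w)) p y≢z , q)
             (∈-free-subst F μ x z∈F)

  ⊆-closed : {xs : List Var} → (∀ {x} → x ∉ xs) → xs ≡ []
  ⊆-closed x∉ = ⊆[]⇒≡[] (⊥-elim ∘ x∉)

  closed-∉ : {xs : List Var} → xs ≡ [] → ∀ {x} → x ∉ xs
  closed-∉ refl ()

  singleton-∈ : {x z : Var} → z ∈ x ∷ [] → x ≡ z
  singleton-∈ (here refl) = refl

subst-closed : (l μ : AList A) (x : Var) →
  vars l ⊆ x ∷ [] → vars μ ≡ [] → vars (l [ μ / x ]) ≡ []
subst-closed l μ x l⊆x μ-closed = ⊆-closed λ z∈ →
  [ (λ (z∈l , x≢z) → x≢z (singleton-∈ (l⊆x z∈l))) , closed-∉ μ-closed ]′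
    (∈-vars-subst l μ x z∈)

substᶠ-closed : (F : Formula A P) (μ : AList A) (x : Var) →
  free F ⊆ x ∷ [] → vars μ ≡ [] → free (F [ μ / x ]ᶠ) ≡ []
substᶠ-closed F μ x F⊆x μ-closed = ⊆-closed λ z∈ →
  [ (λ (z∈F , x≢z) → x≢z (singleton-∈ (F⊆x z∈F))) , closed-∉ μ-closed ]′
    (∈-free-subst F μ x z∈)

quant-closed : (q : Quantifier) (x : Var) (F : Formula A P) →
  free F ⊆ x ∷ [] → free (quant q x F) ≡ []
quant-closed q x F F⊆x = ⊆-closed λ z∈ →
  let z∈F , x≢z = ∈-filter⁻ (λ w → ¬? (x ≟ w)) {xs = free F} z∈
  in x≢z (singleton-∈ (F⊆x z∈F))

ListsIn-args-subst : {𝓛 : Pred (AList A) ℓ} →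
  (∀ {l μ} x → 𝓛 l → 𝓛 μ → 𝓛 (l [ μ / x ])) →
  ∀ {n} (ls : Vec (AList A) n) {μ} x → VecAll.All 𝓛 ls → 𝓛 μ →
  VecAll.All 𝓛 (Vec.map (_[ μ / x ]) ls)
ListsIn-args-subst s [] x [] μ∈ = []
ListsIn-args-subst s (l ∷ ls) x (l∈ ∷ ls∈) μ∈ =
  s x l∈ μ∈ ∷ ListsIn-args-subst s ls x ls∈ μ∈

ListsIn-subst : {A P : Set ℓ} {𝓛 : Pred (AList A) ℓ} →
  (∀ {l μ} x → 𝓛 l → 𝓛 μ → 𝓛 (l [ μ / x ])) →
  (F : Formula A P) {μ : AList A} (x : Var) →
  ListsIn 𝓛 F → 𝓛 μ → ListsIn 𝓛 (F [ μ / x ]ᶠ)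
ListsIn-subst s (k ≐ l) x (k∈ , l∈) μ∈ = s x k∈ μ∈ , s x l∈ μ∈
ListsIn-subst s (atom p ls) x ls∈ μ∈ = ListsIn-args-subst s ls x ls∈ μ∈
ListsIn-subst s (neg F) x F∈ μ∈ = ListsIn-subst s F x F∈ μ∈
ListsIn-subst s (binary c F G) x (F∈ , G∈) μ∈ =
  ListsIn-subst s F x F∈ μ∈ , ListsIn-subst s G x G∈ μ∈
ListsIn-subst s (quant q y F) x F∈ μ∈ with x ≟ y
... | yes _ = F∈
... | no _ = ListsIn-subst s F x F∈ μ∈

------------------------------------------------------------------------
-- Extension of a system by names

-- Names are added as a disjoint summand, hence differ from all symbols
-- of the given system.
nameList : N → AList (A ⊎ N)
nameList κ = ⌊ con (inj₂ κ) ⌋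

byNames : List (Var × N) → List (Var × AList (A ⊎ N))
byNames = map (map₂ nameList)

private
  byNames-comm : (l : AList (A ⊎ N)) (κ : N) (z : Var) (σ : List (Var × N)) →
    All (λ (x , _) → x ≢ z) σ →
    l [ nameList κ / z ] [ byNames σ ]* ≡ l [ byNames σ ]* [ nameList κ / z ]
  byNames-comm l κ z [] [] = refl
  byNames-comm l κ z ((x , ι) ∷ σ) (x≢z ∷ σ≢z) =
    trans (cong (_[ byNames σ ]*)
            (subst-comm l (nameList κ) (nameList ι) (x≢z ∘ sym) λ ()))
          (byNames-comm (l [ nameList ι / x ]) κ z σ σ≢z)

  byNames-inner : (l μ : AList (A ⊎ N)) (x : Var) (σ : List (Var × N)) →
    All (λ (z , _) → z ∉ x ∷ vars l) σ →
    l [ μ [ byNames σ ]* / x ] ≡ l [ μ / x ] [ byNames σ ]*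
  byNames-inner l μ x [] [] = refl
  byNames-inner l μ x ((z , κ) ∷ σ) (z∉ ∷ σ∉) =
    trans (byNames-inner l (μ [ nameList κ / z ]) x σ σ∉)
      (cong (_[ byNames σ ]*) (sym
        (trans (subst-comm l μ (nameList κ) (λ x≡z → z∉ (here (sym x≡z))) λ ())
               (cong (_[ μ [ nameList κ / z ] / x ])
                     (subst-fresh l (nameList κ) (z∉ ∘ there))))))

  byNames-outer : (l μ : AList (A ⊎ N)) (x : Var) (σ : List (Var × N)) →
    All (λ (z , _) → z ∉ x ∷ vars μ) σ →
    l [ byNames σ ]* [ μ / x ] ≡ l [ μ / x ] [ byNames σ ]*
  byNames-outer l μ x [] [] = refl
  byNames-outer l μ x ((z , κ) ∷ σ) (z∉ ∷ σ∉) =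
    trans (byNames-outer (l [ nameList κ / z ]) μ x σ σ∉)
      (cong (_[ byNames σ ]*) (sym
        (trans (subst-comm l μ (nameList κ) (λ x≡z → z∉ (here (sym x≡z))) λ ())
               (cong (l [ nameList κ / z ] [_/ x ])
                     (subst-fresh μ (nameList κ) (z∉ ∘ there))))))

  byNames-++ : (l : AList (A ⊎ N)) (σ τ : List (Var × N)) →
    l [ byNames σ ]* [ byNames τ ]* ≡ l [ byNames (σ ++ τ) ]*
  byNames-++ l [] τ = refl
  byNames-++ l ((x , κ) ∷ σ) τ = byNames-++ (l [ nameList κ / x ]) σ τ

  rename : (l : AList (A ⊎ N)) (κ : N) (y z : Var) → z ∉ y ∷ vars l →
    l [ nameList κ / y ] ≡ l [ ⌊ var z ⌋ / y ] [ nameList κ / z ]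
  rename l κ y z z∉ = sym
    (trans (subst-comm l ⌊ var z ⌋ (nameList κ) (λ y≡z → z∉ (here (sym y≡z))) λ ())
      (trans (cong (_[ ⌊ var z ⌋ [ nameList κ / z ] / y ])
                   (subst-fresh l (nameList κ) (z∉ ∘ there)))
             (cong (l [_/ y ]) (subst-var (nameList κ) z))))

  fresh : (xs : List Var) → ∃ λ z → z ∉ xs
  fresh xs = z , λ z∈ → <-irrefl refl (All.lookup (xs≤max 0 xs) z∈)
    where z = ℕ.suc (max 0 xs)

module _ {A P : Set ℓ} (S : FormalSystem A P) (N : Set ℓ) where
  open FormalSystem S

  𝓛̂ : Pred (AList (A ⊎ N)) ℓ
  𝓛̂ ρ = ∃₂ λ (l : AList A) (σ : List (Var × N)) →
    𝓛 l × ρ ≡ embed inj₁ l [ byNames σ ]*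

  private
    Apart : List Var → AList (A ⊎ N) → Set ℓ
    Apart zs ρ = ∃₂ λ (l : AList A) (σ : List (Var × N)) →
      𝓛 l × ρ ≡ embed inj₁ l [ byNames σ ]* × All (λ (x , _) → x ∉ zs) σ

    apart : (zs : List Var) (l : AList A) (σ : List (Var × N)) → 𝓛 l →
      Apart zs (embed inj₁ l [ byNames σ ]*)
    apart zs l [] l∈ = l , [] , l∈ , refl , []
    apart zs l ((y , κ) ∷ σ) l∈ with fresh (y ∷ vars l ++ zs ++ map proj₁ σ)
    ... | z , z∉ with apart zs (l [ ⌊ var z ⌋ / y ]) σ (𝓛-subst y l∈ (X⊆𝓛 z))
    ... | l′ , σ′ , l′∈ , eq , σ′∉ =
      l′ , σ′ ++ (z , κ) ∷ [] , l′∈ , eq′ , ++⁺ σ′∉ ((z∉zs ∷ []))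
      where
      l̂ = embed inj₁ l
      z∉zs : z ∉ zs
      z∉zs = z∉ ∘ there ∘ ∈-++⁺ʳ (vars l) ∘ ∈-++⁺ˡ
      z∉y∷l : z ∉ y ∷ vars l̂
      z∉y∷l (here z≡y) = z∉ (here z≡y)
      z∉y∷l (there z∈) =
        z∉ (there (∈-++⁺ˡ (subst (z ∈_) (vars-embed inj₁ l) z∈)))
      σ≢z : (τ : List (Var × N)) → z ∉ map proj₁ τ → All (λ (x , _) → x ≢ z) τ
      σ≢z [] _ = []
      σ≢z (_ ∷ τ) z∉τ = (z∉τ ∘ here ∘ sym) ∷ σ≢z τ (z∉τ ∘ there)
      eq′ : l̂ [ nameList κ / y ] [ byNames σ ]*
              ≡ embed inj₁ l′ [ byNames (σ′ ++ (z , κ) ∷ []) ]*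
      eq′ =
        trans (cong (_[ byNames σ ]*) (rename l̂ κ y z z∉y∷l))
        (trans (byNames-comm (l̂ [ ⌊ var z ⌋ / y ]) κ z σ
                 (σ≢z σ (z∉ ∘ there ∘ ∈-++⁺ʳ (vars l) ∘ ∈-++⁺ʳ zs)))
        (trans (cong (_[ nameList κ / z ])
                 (trans (cong (_[ byNames σ ]*)
                          (sym (embed-subst inj₁ l ⌊ var z ⌋ y)))
                        eq))
               (byNames-++ (embed inj₁ l′) σ′ ((z , κ) ∷ []))))

  𝓛̂-var : ∀ x → 𝓛̂ ⌊ var x ⌋
  𝓛̂-var x = ⌊ var x ⌋ , [] , X⊆𝓛 x , refl

  𝓛̂-name : ∀ κ → 𝓛̂ (nameList κ)
  𝓛̂-name κ = ⌊ var 0 ⌋ , (0 , κ) ∷ [] , X⊆𝓛 0 , refl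

  𝓛̂-subst : ∀ {l μ} x → 𝓛̂ l → 𝓛̂ μ → 𝓛̂ (l [ μ / x ])
  𝓛̂-subst {l} x (l₀ , σ₀ , l₀∈ , refl) (μ₀ , τ₀ , μ₀∈ , refl)
    with apart (x ∷ vars l) μ₀ τ₀ μ₀∈
  ... | m , τ , m∈ , μ≡ , τ∉ with apart (x ∷ vars (embed {A′ = A ⊎ N} inj₁ m)) l₀ σ₀ l₀∈
  ... | k , σ , k∈ , l≡ , σ∉ = k [ m / x ] , σ ++ τ , 𝓛-subst x k∈ m∈ ,
    trans (cong (l [_/ x ]) μ≡)
    (trans (byNames-inner l m̂ x τ τ∉)
    (trans (cong (λ ◻ → ◻ [ m̂ / x ] [ byNames τ ]*) l≡)
    (trans (cong (_[ byNames τ ]*) (byNames-outer (embed inj₁ k) m̂ x σ σ∉))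
    (trans (cong (λ ◻ → ◻ [ byNames σ ]* [ byNames τ ]*)
                 (sym (embed-subst inj₁ k m x)))
           (byNames-++ (embed inj₁ (k [ m / x ])) σ τ)))))
    where m̂ = embed inj₁ m

  private
    𝓛̂-embed : {l : AList A} → 𝓛 l → 𝓛̂ (embed inj₁ l)
    𝓛̂-embed {l} l∈ = l , [] , l∈ , refl

    𝓛̂-embed-args : ∀ {n} (ls : Vec (AList A) n) → VecAll.All 𝓛 ls →
      VecAll.All 𝓛̂ (Vec.map (embed inj₁) ls)
    𝓛̂-embed-args [] [] = []
    𝓛̂-embed-args (l ∷ ls) (l∈ ∷ ls∈) = 𝓛̂-embed l∈ ∷ 𝓛̂-embed-args ls ls∈

  embed-formula : (F : Formula A P) → IsFormula F → ListsIn 𝓛̂ (embedᶠ inj₁ F)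
  embed-formula (l ≐ μ) (l∈ , μ∈) = 𝓛̂-embed l∈ , 𝓛̂-embed μ∈
  embed-formula (atom p ls) ls∈ = 𝓛̂-embed-args ls ls∈
  embed-formula (neg F) F∈ = embed-formula F F∈
  embed-formula (binary c F G) (F∈ , G∈) = embed-formula F F∈ , embed-formula G G∈
  embed-formula (quant q x F) F∈ = embed-formula F F∈

  extension : FormalSystem (A ⊎ N) P
  extension = record
    { 𝓛 = 𝓛̂
    ; X⊆𝓛 = 𝓛̂-var
    ; 𝓛-subst = 𝓛̂-subst
    ; B = λ F → ∃ λ G → B G × F ≡ embedᶠ inj₁ G
    ; B-lists = λ { (G , G∈B , refl) → embed-formula G (B-lists G∈B) }
    }

------------------------------------------------------------------------
-- Closed lists and sentences of a system

module _ {A P : Set ℓ} (S : FormalSystem A P) where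
  open FormalSystem S

  ClosedList : Pred (AList A) ℓ
  ClosedList l = 𝓛 l × vars l ≡ []

  Sentence : Pred (Formula A P) ℓ
  Sentence F = IsFormula F × free F ≡ []

  instance-list : ∀ l {μ} x → 𝓛 l → vars l ⊆ x ∷ [] → ClosedList μ →
    ClosedList (l [ μ / x ])
  instance-list l {μ} x l∈ l⊆x (μ∈ , μ-closed) =
    𝓛-subst x l∈ μ∈ , subst-closed l μ x l⊆x μ-closed

  ≐-sentence : ∀ {l μ} → ClosedList l → ClosedList μ → Sentence (l ≐ μ)
  ≐-sentence (l∈ , l-closed) (μ∈ , μ-closed) =
    (l∈ , μ∈) , cong₂ _++_ l-closed μ-closed

  atom-sentence : ∀ p {n} {ls : Vec (AList A) n} → VecAll.All ClosedList ls →
    Sentence (atom p ls)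
  atom-sentence p [] = [] , refl
  atom-sentence p ((l∈ , l-closed) ∷ ls∈) with atom-sentence p ls∈
  ... | ls∈′ , ls-closed = (l∈ ∷ ls∈′) , cong₂ _++_ l-closed ls-closed

  binary-sentence : ∀ c F G → Sentence F → Sentence G → Sentence (binary c F G)
  binary-sentence c F G (F∈ , F-closed) (G∈ , G-closed) =
    (F∈ , G∈) , cong₂ _++_ F-closed G-closed

  quant-sentence : ∀ q x F → IsFormula F → free F ⊆ x ∷ [] →
    Sentence (quant q x F)
  quant-sentence q x F F∈ F⊆x = F∈ , quant-closed q x F F⊆x

  instance-sentence : ∀ x F {μ} → IsFormula F → free F ⊆ x ∷ [] →
    ClosedList μ → Sentence (F [ μ / x ]ᶠ)
  instance-sentence x F {μ} F∈ F⊆x (μ∈ , μ-closed) =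
    ListsIn-subst 𝓛-subst F x F∈ μ∈ , substᶠ-closed F μ x F⊆x μ-closed

  instances-sentence : ∀ F (σ : List (Var × AList A)) → IsFormula F →
    free F ⊆ map proj₁ σ → All (ClosedList ∘ proj₂) σ → Sentence (F [ σ ]ᶠ*)
  instances-sentence F [] F∈ F⊆ [] = F∈ , ⊆[]⇒≡[] F⊆
  instances-sentence F ((x , μ) ∷ σ) F∈ F⊆ ((μ∈ , μ-closed) ∷ σ-closed) =
    instances-sentence (F [ μ / x ]ᶠ) σ (ListsIn-subst 𝓛-subst F x F∈ μ∈)
      ⊆σ σ-closed
    where
    drop-x : ∀ {z} → x ≢ z → z ∈ x ∷ map proj₁ σ → z ∈ map proj₁ σ
    drop-x x≢z (here z≡x) = ⊥-elim (x≢z (sym z≡x))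
    drop-x x≢z (there z∈) = z∈
    ⊆σ : free (F [ μ / x ]ᶠ) ⊆ map proj₁ σ
    ⊆σ z∈ = [ (λ (z∈F , x≢z) → drop-x x≢z (F⊆ z∈F))
            , ⊥-elim ∘ closed-∉ μ-closed ]′ (∈-free-subst F μ x z∈)

------------------------------------------------------------------------
-- Models

record Model {A P : Set ℓ} (S : FormalSystem A P) : Set (suc ℓ) where
  field
    Individual : Set ℓ
    inhabited : Individual
    Name : Set ℓ
    name : Individual → Name
    name-bijective : Bijective _≡_ _≡_ name

  Ŝ : FormalSystem (A ⊎ Name) P
  Ŝ = extension S Name

  open FormalSystem Ŝ using () renaming (𝓛 to 𝓛ˣ; IsFormula to IsFormulaˣ)

  α : Individual → AList (A ⊎ Name)
  α d = nameList (name d)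

  α-closed : ∀ d → ClosedList Ŝ (α d)
  α-closed d = 𝓛̂-name S Name (name d) , refl

  -- The membership proofs given to ⟦_⟧ and truth are irrelevant, so
  -- these are functions on sets of closed lists and closed formulas.
  field
    ⟦_⟧ : (l : AList (A ⊎ Name)) → .(ClosedList Ŝ l) → Individual
    ⟦⟧-surjective : ∀ d → ∃ λ l → Σ (ClosedList Ŝ l) λ l∈ → ⟦ l ⟧ l∈ ≡ d
    ⟦⟧-subst : ∀ x l μ (l∈ : 𝓛ˣ l) (l⊆x : vars l ⊆ x ∷ [])
      (μ∈ : ClosedList Ŝ μ) →
      ⟦ l [ μ / x ] ⟧ (instance-list Ŝ l x l∈ l⊆x μ∈) ≡
      ⟦ l [ α (⟦ μ ⟧ μ∈) / x ] ⟧
        (instance-list Ŝ l x l∈ l⊆x (α-closed (⟦ μ ⟧ μ∈)))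

    -- n-ary predicates as characteristic functions; for n = 0 a truth value.
    predicate : P → (n : ℕ) → Vec Individual n → Bool

    truth : (F : Formula (A ⊎ Name) P) → .(Sentence Ŝ F) → Bool
    truth-≐ : ∀ {l μ} (l∈ : ClosedList Ŝ l) (μ∈ : ClosedList Ŝ μ) →
      truth (l ≐ μ) (≐-sentence Ŝ l∈ μ∈) ≡ true ⇔ ⟦ l ⟧ l∈ ≡ ⟦ μ ⟧ μ∈
    truth-atom : ∀ p {n} {ls : Vec (AList (A ⊎ Name)) n}
      (ls∈ : VecAll.All (ClosedList Ŝ) ls) →
      truth (atom p ls) (atom-sentence Ŝ p ls∈) ≡
      predicate p n (VecAll.reduce (λ {l} l∈ → ⟦ l ⟧ l∈) ls∈)
    truth-neg : ∀ {F} (F∈ : Sentence Ŝ F) → truth (neg F) F∈ ≡ not (truth F F∈)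
    truth-binary : ∀ c {F G} (F∈ : Sentence Ŝ F) (G∈ : Sentence Ŝ G) →
      truth (binary c F G) (binary-sentence Ŝ c F G F∈ G∈) ≡
      ⟦ c ⟧ᶜ (truth F F∈) (truth G G∈)
    truth-∀ : ∀ x F (F∈ : IsFormulaˣ F) (F⊆x : free F ⊆ x ∷ []) →
      truth (all x F) (quant-sentence Ŝ ∀′ x F F∈ F⊆x) ≡ true ⇔
      (∀ l (l∈ : ClosedList Ŝ l) →
        truth (F [ l / x ]ᶠ) (instance-sentence Ŝ x F F∈ F⊆x l∈) ≡ true)
    truth-∃ : ∀ x F (F∈ : IsFormulaˣ F) (F⊆x : free F ⊆ x ∷ []) →
      truth (ex x F) (quant-sentence Ŝ ∃′ x F F∈ F⊆x) ≡ true ⇔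
      (∃ λ l → Σ (ClosedList Ŝ l) λ l∈ →
        truth (F [ l / x ]ᶠ) (instance-sentence Ŝ x F F∈ F⊆x l∈) ≡ true)

  -- σ = (x₁ , λ₁) , … , (xₘ , λₘ) with free(F) = {x₁ , … , xₘ}. A repeated
  -- xᵢ is harmless, since its later substitutions have no effect.
  Valid : (F : Formula (A ⊎ Name) P) → IsFormulaˣ F → Set ℓ
  Valid F F∈ = (σ : List (Var × AList (A ⊎ Name)))
    (F⊆σ : free F ⊆ map proj₁ σ) → map proj₁ σ ⊆ free F →
    (σ-closed : All (ClosedList Ŝ ∘ proj₂) σ) →
    truth (F [ σ ]ᶠ*) (instances-sentence Ŝ F σ F∈ F⊆σ σ-closed) ≡ true

  field
    basis-valid : ∀ {F} (F∈B : FormalSystem.B S F) →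
      Valid (embedᶠ inj₁ F)
            (embed-formula S Name F (FormalSystem.B-lists S F∈B))

module Submission where

-- The idea is Tarski's: a formula is read under an environment ρ that
-- sends every variable to a closed list of the extended system, by
-- substituting ρ simultaneously and taking the truth value of the resulting
-- sentence (truthAt). Validity is truth under all such environments
-- (valid⇒true, true⇒valid): the successive substitution of closed lists is
-- the simultaneous one, and values outside the free variables do not
-- matter. Working with total environments removes the bookkeeping of free
-- variables; in detachment, for instance, variables free only in the
-- premise need no separate treatment.
--
-- Induction on derivations (sound) then shows that every provable formula
-- is true under every closing environment. The cases rest on the following.
--  * The clauses of the model turn into the usual recursive truth
--    conditions for truthAt; a quantifier on x ranges over the updates of
--    ρ at x (∀-intro, ∀-inst, ∃-intro, ∃-witness), by ⟪⟫ᶠ-subst.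
--  * The substitution rule is the substitution lemma subst-⟪⟫ᶠ, the only
--    place where freedom from collisions is essential.
--  * The equality axiom for lists holds because the value of l under ρ
--    depends only on the values of the lists ρ z (⟦⟧-update): ⟦⟧-subst
--    allows a closed list to be replaced by the name of its value.
--  * All of this requires that substituting a closing environment stays
--    inside the lists of the system, which are closed only under single
--    substitutions (⟪⟫-list), and that provable formulas are formulas of
--    the system (provable-formula).

open import Defs
open import Level using (Level)
open import Data.Bool.Base using (Bool; true; false; not)
open import Data.Empty using (⊥-elim)
open import Data.Fin.Base using (Fin)
open import Data.List.Base using (List; []; _∷_; map; concatMap)
open import Data.List.Membership.Propositional using (_∈_; _∉_)
open import Data.List.Membership.Propositional.Properties
  using (∈-++⁺ˡ; ∈-++⁺ʳ; ∈-++⁻; ∈-filter⁺; ∈-filter⁻)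
open import Data.List.Relation.Unary.All as All using (All; []; _∷_)
open import Data.List.Relation.Unary.Any using (here; there)
open import Data.List.Relation.Binary.Subset.Propositional using (_⊆_)
open import Data.List.Relation.Binary.Subset.Propositional.Properties using (⊆[]⇒≡[])
open import Data.Nat.Properties using (_≟_)
open import Data.Product.Base using (Σ; ∃; _×_; _,_; proj₁; proj₂)
open import Data.Sum.Base using (_⊎_; inj₁; inj₂)
open import Data.Vec.Base as Vec using (Vec; []; _∷_; toList)
open import Data.Vec.Relation.Unary.All as VecAll using ([]; _∷_)
open import Data.Vec.Relation.Binary.Pointwise.Inductive using (Pointwise; []; _∷_)
open import Function.Base using (_∘_)
open import Function.Bundles using (module Equivalence)
open import Relation.Binary.PropositionalEquality
  using (_≡_; _≢_; _≗_; refl; sym; trans; cong; cong₂; subst)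
open import Relation.Nullary using (¬_; yes; no)
open import Relation.Nullary.Decidable using (¬?)

private
  variable
    ℓ : Level
    A P : Set ℓ

-- Simultaneous substitution

-- Environments are total; only the values at the variables of the list or
-- formula at hand matter.
Env : Set ℓ → Set ℓ
Env A = Var → AList A

idEnv : Env A
idEnv x = ⌊ var x ⌋

infixl 30 _[_↦_] _⟪_⟫ᵢ _⟪_⟫ _⟪_⟫ᶠ

-- The environment that sends x to μ and is ρ elsewhere.
_[_↦_] : Env A → Var → AList A → Env A
(ρ [ x ↦ μ ]) z with x ≟ z
... | yes _ = μ
... | no _ = ρ z

-- Every variable z is replaced by ρ z, in one step.
mutual
  _⟪_⟫ᵢ : Item A → Env A → AList A
  var x ⟪ ρ ⟫ᵢ = ρ x
  con a ⟪ ρ ⟫ᵢ = ⌊ con a ⌋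
  app f l ⟪ ρ ⟫ᵢ = ⌊ app f (l ⟪ ρ ⟫) ⌋

  _⟪_⟫ : AList A → Env A → AList A
  ⌊ i ⌋ ⟪ ρ ⟫ = i ⟪ ρ ⟫ᵢ
  (i ◃ l) ⟪ ρ ⟫ = i ⟪ ρ ⟫ᵢ ⌢ l ⟪ ρ ⟫

-- Like the single substitution, this one may capture variables of the
-- substituted lists; a quantified variable itself is left alone.
_⟪_⟫ᶠ : Formula A P → Env A → Formula A P
(l ≐ μ) ⟪ ρ ⟫ᶠ = l ⟪ ρ ⟫ ≐ μ ⟪ ρ ⟫
atom p ls ⟪ ρ ⟫ᶠ = atom p (Vec.map (_⟪ ρ ⟫) ls)
neg F ⟪ ρ ⟫ᶠ = neg (F ⟪ ρ ⟫ᶠ)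
binary c F G ⟪ ρ ⟫ᶠ = binary c (F ⟪ ρ ⟫ᶠ) (G ⟪ ρ ⟫ᶠ)
quant q x F ⟪ ρ ⟫ᶠ = quant q x (F ⟪ ρ [ x ↦ ⌊ var x ⌋ ] ⟫ᶠ)

private
  closed-∉ : {xs : List Var} → xs ≡ [] → ∀ {x} → x ∉ xs
  closed-∉ refl ()

  ⊆-closed : {xs : List Var} → (∀ {x} → x ∉ xs) → xs ≡ []
  ⊆-closed x∉ = ⊆[]⇒≡[] (⊥-elim ∘ x∉)

update-same : (ρ : Env A) (x : Var) (μ : AList A) → (ρ [ x ↦ μ ]) x ≡ μ
update-same ρ x μ with x ≟ x
... | yes _ = refl
... | no x≢x = ⊥-elim (x≢x refl)

update-other : (ρ : Env A) (x : Var) {z : Var} (μ : AList A) → x ≢ z →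
  (ρ [ x ↦ μ ]) z ≡ ρ z
update-other ρ x {z} μ x≢z with x ≟ z
... | yes x≡z = ⊥-elim (x≢z x≡z)
... | no _ = refl

update-self : (ρ : Env A) (x : Var) → ρ [ x ↦ ρ x ] ≗ ρ
update-self ρ x z with x ≟ z
... | yes refl = refl
... | no _ = refl

update-overwrite : (ρ : Env A) (x : Var) (μ ν : AList A) →
  ρ [ x ↦ μ ] [ x ↦ ν ] ≗ ρ [ x ↦ ν ]
update-overwrite ρ x μ ν z with x ≟ z
... | yes _ = refl
... | no x≢z = update-other ρ x μ x≢z

update-swap : (ρ : Env A) {x y : Var} (μ ν : AList A) → x ≢ y →
  ρ [ x ↦ μ ] [ y ↦ ν ] ≗ ρ [ y ↦ ν ] [ x ↦ μ ]
update-swap ρ {x} {y} μ ν x≢y z with y ≟ z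
... | yes refl =
  sym (trans (update-other (ρ [ y ↦ ν ]) x μ x≢y) (update-same ρ y ν))
... | no y≢z with x ≟ z
... | yes _ = refl
... | no _ = sym (update-other ρ y ν y≢z)

-- Laws of simultaneous substitution into lists

⌢-assoc : (k l m : AList A) → (k ⌢ l) ⌢ m ≡ k ⌢ (l ⌢ m)
⌢-assoc ⌊ i ⌋ l m = refl
⌢-assoc (i ◃ k) l m = cong (i ◃_) (⌢-assoc k l m)

⌢-⟪⟫ : (k l : AList A) (ρ : Env A) → (k ⌢ l) ⟪ ρ ⟫ ≡ k ⟪ ρ ⟫ ⌢ l ⟪ ρ ⟫
⌢-⟪⟫ ⌊ i ⌋ l ρ = refl
⌢-⟪⟫ (i ◃ k) l ρ =
  trans (cong (i ⟪ ρ ⟫ᵢ ⌢_) (⌢-⟪⟫ k l ρ))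
        (sym (⌢-assoc (i ⟪ ρ ⟫ᵢ) (k ⟪ ρ ⟫) (l ⟪ ρ ⟫)))

mutual
  ⟪⟫ᵢ-cong : (i : Item A) {ρ τ : Env A} →
    (∀ {z} → z ∈ varsᵢ i → ρ z ≡ τ z) → i ⟪ ρ ⟫ᵢ ≡ i ⟪ τ ⟫ᵢ
  ⟪⟫ᵢ-cong (var x) ρ≡τ = ρ≡τ (here refl)
  ⟪⟫ᵢ-cong (con a) ρ≡τ = refl
  ⟪⟫ᵢ-cong (app f l) ρ≡τ = cong (⌊_⌋ ∘ app f) (⟪⟫-cong l ρ≡τ)

  ⟪⟫-cong : (l : AList A) {ρ τ : Env A} →
    (∀ {z} → z ∈ vars l → ρ z ≡ τ z) → l ⟪ ρ ⟫ ≡ l ⟪ τ ⟫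
  ⟪⟫-cong ⌊ i ⌋ ρ≡τ = ⟪⟫ᵢ-cong i ρ≡τ
  ⟪⟫-cong (i ◃ l) ρ≡τ =
    cong₂ _⌢_ (⟪⟫ᵢ-cong i (ρ≡τ ∘ ∈-++⁺ˡ)) (⟪⟫-cong l (ρ≡τ ∘ ∈-++⁺ʳ (varsᵢ i)))

mutual
  ⟪id⟫ᵢ : (i : Item A) → i ⟪ idEnv ⟫ᵢ ≡ ⌊ i ⌋
  ⟪id⟫ᵢ (var x) = refl
  ⟪id⟫ᵢ (con a) = refl
  ⟪id⟫ᵢ (app f l) = cong (⌊_⌋ ∘ app f) (⟪id⟫ l)

  ⟪id⟫ : (l : AList A) → l ⟪ idEnv ⟫ ≡ l
  ⟪id⟫ ⌊ i ⌋ = ⟪id⟫ᵢ i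
  ⟪id⟫ (i ◃ l) = cong₂ _⌢_ (⟪id⟫ᵢ i) (⟪id⟫ l)

mutual
  ⟪⟫ᵢ-comp : (i : Item A) (ρ τ : Env A) →
    i ⟪ ρ ⟫ᵢ ⟪ τ ⟫ ≡ i ⟪ (λ z → ρ z ⟪ τ ⟫) ⟫ᵢ
  ⟪⟫ᵢ-comp (var x) ρ τ = refl
  ⟪⟫ᵢ-comp (con a) ρ τ = refl
  ⟪⟫ᵢ-comp (app f l) ρ τ = cong (⌊_⌋ ∘ app f) (⟪⟫-comp l ρ τ)

  ⟪⟫-comp : (l : AList A) (ρ τ : Env A) →
    l ⟪ ρ ⟫ ⟪ τ ⟫ ≡ l ⟪ (λ z → ρ z ⟪ τ ⟫) ⟫
  ⟪⟫-comp ⌊ i ⌋ ρ τ = ⟪⟫ᵢ-comp i ρ τ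
  ⟪⟫-comp (i ◃ l) ρ τ =
    trans (⌢-⟪⟫ (i ⟪ ρ ⟫ᵢ) (l ⟪ ρ ⟫) τ)
          (cong₂ _⌢_ (⟪⟫ᵢ-comp i ρ τ) (⟪⟫-comp l ρ τ))

mutual
  substᵢ-as-⟪⟫ : (i : Item A) (μ : AList A) (x : Var) →
    i [ μ / x ]ᵢ ≡ i ⟪ idEnv [ x ↦ μ ] ⟫ᵢ
  substᵢ-as-⟪⟫ (var y) μ x with x ≟ y
  ... | yes _ = refl
  ... | no _ = refl
  substᵢ-as-⟪⟫ (con a) μ x = refl
  substᵢ-as-⟪⟫ (app f l) μ x = cong (⌊_⌋ ∘ app f) (subst-as-⟪⟫ l μ x)

  subst-as-⟪⟫ : (l μ : AList A) (x : Var) →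
    l [ μ / x ] ≡ l ⟪ idEnv [ x ↦ μ ] ⟫
  subst-as-⟪⟫ ⌊ i ⌋ μ x = substᵢ-as-⟪⟫ i μ x
  subst-as-⟪⟫ (i ◃ l) μ x =
    cong₂ _⌢_ (substᵢ-as-⟪⟫ i μ x) (subst-as-⟪⟫ l μ x)

⟪⟫-fixed : (l : AList A) (ρ : Env A) →
  (∀ {z} → z ∈ vars l → ρ z ≡ ⌊ var z ⌋) → l ⟪ ρ ⟫ ≡ l
⟪⟫-fixed l ρ fixed = trans (⟪⟫-cong l fixed) (⟪id⟫ l)

⟪⟫-closed : (l : AList A) (ρ : Env A) → vars l ≡ [] → l ⟪ ρ ⟫ ≡ l
⟪⟫-closed l ρ l-closed = ⟪⟫-fixed l ρ (⊥-elim ∘ closed-∉ l-closed)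

-- The substitution lemma for lists.
subst-⟪⟫ : (l μ : AList A) (x : Var) (ρ : Env A) →
  l [ μ / x ] ⟪ ρ ⟫ ≡ l ⟪ ρ [ x ↦ μ ⟪ ρ ⟫ ] ⟫
subst-⟪⟫ l μ x ρ =
  trans (cong (_⟪ ρ ⟫) (subst-as-⟪⟫ l μ x))
  (trans (⟪⟫-comp l (idEnv [ x ↦ μ ]) ρ) (⟪⟫-cong l λ {z} _ → pointwise z))
  where
  pointwise : ∀ z → (idEnv [ x ↦ μ ]) z ⟪ ρ ⟫ ≡ (ρ [ x ↦ μ ⟪ ρ ⟫ ]) z
  pointwise z with x ≟ z
  ... | yes _ = refl
  ... | no _ = refl

-- Completing an environment that leaves x alone.
⟪⟫-subst : (l μ : AList A) (x : Var) (ρ : Env A) →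
  (∀ {z} → x ≢ z → x ∉ vars (ρ z)) →
  l ⟪ ρ [ x ↦ ⌊ var x ⌋ ] ⟫ [ μ / x ] ≡ l ⟪ ρ [ x ↦ μ ] ⟫
⟪⟫-subst l μ x ρ x∉ρ =
  trans (subst-as-⟪⟫ (l ⟪ ρ [ x ↦ ⌊ var x ⌋ ] ⟫) μ x)
  (trans (⟪⟫-comp l (ρ [ x ↦ ⌊ var x ⌋ ]) (idEnv [ x ↦ μ ]))
         (⟪⟫-cong l λ {z} _ → pointwise z))
  where
  pointwise : ∀ z →
    (ρ [ x ↦ ⌊ var x ⌋ ]) z ⟪ idEnv [ x ↦ μ ] ⟫ ≡ (ρ [ x ↦ μ ]) z
  pointwise z with x ≟ z
  ... | yes _ = update-same idEnv x μ
  ... | no x≢z = ⟪⟫-fixed (ρ z) (idEnv [ x ↦ μ ]) λ w∈ →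
    update-other idEnv x μ λ { refl → x∉ρ x≢z w∈ }

∈-vars-⌢ : (k l : AList A) {z : Var} →
  z ∈ vars (k ⌢ l) → z ∈ vars k ⊎ z ∈ vars l
∈-vars-⌢ ⌊ i ⌋ l z∈ = ∈-++⁻ (varsᵢ i) z∈
∈-vars-⌢ (i ◃ k) l z∈ with ∈-++⁻ (varsᵢ i) z∈
... | inj₁ z∈i = inj₁ (∈-++⁺ˡ z∈i)
... | inj₂ z∈kl with ∈-vars-⌢ k l z∈kl
... | inj₁ z∈k = inj₁ (∈-++⁺ʳ (varsᵢ i) z∈k)
... | inj₂ z∈l = inj₂ z∈l

mutual
  ∈-varsᵢ-⟪⟫ : (i : Item A) (ρ : Env A) {z : Var} → z ∈ vars (i ⟪ ρ ⟫ᵢ) →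
    ∃ λ y → y ∈ varsᵢ i × z ∈ vars (ρ y)
  ∈-varsᵢ-⟪⟫ (var x) ρ z∈ = x , here refl , z∈
  ∈-varsᵢ-⟪⟫ (app f l) ρ z∈ = ∈-vars-⟪⟫ l ρ z∈

  ∈-vars-⟪⟫ : (l : AList A) (ρ : Env A) {z : Var} → z ∈ vars (l ⟪ ρ ⟫) →
    ∃ λ y → y ∈ vars l × z ∈ vars (ρ y)
  ∈-vars-⟪⟫ ⌊ i ⌋ ρ z∈ = ∈-varsᵢ-⟪⟫ i ρ z∈
  ∈-vars-⟪⟫ (i ◃ l) ρ z∈ with ∈-vars-⌢ (i ⟪ ρ ⟫ᵢ) (l ⟪ ρ ⟫) z∈
  ... | inj₁ z∈i = let y , y∈ , z∈y = ∈-varsᵢ-⟪⟫ i ρ z∈i in y , ∈-++⁺ˡ y∈ , z∈y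
  ... | inj₂ z∈l =
    let y , y∈ , z∈y = ∈-vars-⟪⟫ l ρ z∈l in y , ∈-++⁺ʳ (varsᵢ i) y∈ , z∈y

-- Laws of simultaneous substitution into formulas

∈-free-quant⁺ : (F : Formula A P) (x : Var) {q : Quantifier} {z : Var} →
  z ∈ free F → x ≢ z → z ∈ free (quant q x F)
∈-free-quant⁺ F x = ∈-filter⁺ (λ w → ¬? (x ≟ w))

∈-free-quant⁻ : (F : Formula A P) (x : Var) {q : Quantifier} {z : Var} →
  z ∈ free (quant q x F) → z ∈ free F × x ≢ z
∈-free-quant⁻ F x = ∈-filter⁻ (λ w → ¬? (x ≟ w)) {xs = free F}

⟪⟫ᵛ-cong : ∀ {n} (ls : Vec (AList A) n) {ρ τ : Env A} →
  (∀ {z} → z ∈ concatMap vars (toList ls) → ρ z ≡ τ z) →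
  Vec.map (_⟪ ρ ⟫) ls ≡ Vec.map (_⟪ τ ⟫) ls
⟪⟫ᵛ-cong [] ρ≡τ = refl
⟪⟫ᵛ-cong (l ∷ ls) ρ≡τ =
  cong₂ _∷_ (⟪⟫-cong l (ρ≡τ ∘ ∈-++⁺ˡ)) (⟪⟫ᵛ-cong ls (ρ≡τ ∘ ∈-++⁺ʳ (vars l)))

⟪⟫ᶠ-cong : (F : Formula A P) {ρ τ : Env A} →
  (∀ {z} → z ∈ free F → ρ z ≡ τ z) → F ⟪ ρ ⟫ᶠ ≡ F ⟪ τ ⟫ᶠ
⟪⟫ᶠ-cong (l ≐ μ) ρ≡τ =
  cong₂ _≐_ (⟪⟫-cong l (ρ≡τ ∘ ∈-++⁺ˡ)) (⟪⟫-cong μ (ρ≡τ ∘ ∈-++⁺ʳ (vars l)))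
⟪⟫ᶠ-cong (atom p ls) ρ≡τ = cong (λ ks → atom p ks) (⟪⟫ᵛ-cong ls ρ≡τ)
⟪⟫ᶠ-cong (neg F) ρ≡τ = cong neg (⟪⟫ᶠ-cong F ρ≡τ)
⟪⟫ᶠ-cong (binary c F G) ρ≡τ =
  cong₂ (binary c) (⟪⟫ᶠ-cong F (ρ≡τ ∘ ∈-++⁺ˡ))
                   (⟪⟫ᶠ-cong G (ρ≡τ ∘ ∈-++⁺ʳ (free F)))
⟪⟫ᶠ-cong (quant q x F) {ρ} {τ} ρ≡τ = cong (quant q x) (⟪⟫ᶠ-cong F agree)
  where
  agree : ∀ {z} → z ∈ free F →
    (ρ [ x ↦ ⌊ var x ⌋ ]) z ≡ (τ [ x ↦ ⌊ var x ⌋ ]) z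
  agree {z} z∈ with x ≟ z
  ... | yes _ = refl
  ... | no x≢z = ρ≡τ (∈-free-quant⁺ F x {q} z∈ x≢z)

⟪⟫ᶠ-ext : (F : Formula A P) {ρ τ : Env A} → ρ ≗ τ → F ⟪ ρ ⟫ᶠ ≡ F ⟪ τ ⟫ᶠ
⟪⟫ᶠ-ext F ρ≗τ = ⟪⟫ᶠ-cong F λ {z} _ → ρ≗τ z

⟪id⟫ᵛ : ∀ {n} (ls : Vec (AList A) n) → Vec.map (_⟪ idEnv ⟫) ls ≡ ls
⟪id⟫ᵛ [] = refl
⟪id⟫ᵛ (l ∷ ls) = cong₂ _∷_ (⟪id⟫ l) (⟪id⟫ᵛ ls)

⟪id⟫ᶠ : (F : Formula A P) → F ⟪ idEnv ⟫ᶠ ≡ F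
⟪id⟫ᶠ (l ≐ μ) = cong₂ _≐_ (⟪id⟫ l) (⟪id⟫ μ)
⟪id⟫ᶠ (atom p ls) = cong (λ ks → atom p ks) (⟪id⟫ᵛ ls)
⟪id⟫ᶠ (neg F) = cong neg (⟪id⟫ᶠ F)
⟪id⟫ᶠ (binary c F G) = cong₂ (binary c) (⟪id⟫ᶠ F) (⟪id⟫ᶠ G)
⟪id⟫ᶠ (quant q x F) =
  cong (quant q x) (trans (⟪⟫ᶠ-ext F (update-self idEnv x)) (⟪id⟫ᶠ F))

⟪⟫ᶠ-closed : (F : Formula A P) (ρ : Env A) → free F ≡ [] → F ⟪ ρ ⟫ᶠ ≡ F
⟪⟫ᶠ-closed F ρ F-closed =
  trans (⟪⟫ᶠ-cong F (⊥-elim ∘ closed-∉ F-closed)) (⟪id⟫ᶠ F)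

subst-⟪⟫ᵛ : ∀ {n} (ls : Vec (AList A) n) (μ : AList A) (x : Var) (ρ : Env A) →
  Vec.map (_⟪ ρ ⟫) (Vec.map (_[ μ / x ]) ls) ≡
  Vec.map (_⟪ ρ [ x ↦ μ ⟪ ρ ⟫ ] ⟫) ls
subst-⟪⟫ᵛ [] μ x ρ = refl
subst-⟪⟫ᵛ (l ∷ ls) μ x ρ = cong₂ _∷_ (subst-⟪⟫ l μ x ρ) (subst-⟪⟫ᵛ ls μ x ρ)

-- The substitution lemma for formulas. Nothing is assumed of ρ, since both
-- sides capture the same variables of ρ.
subst-⟪⟫ᶠ : (F : Formula A P) (μ : AList A) (x : Var) (ρ : Env A) →
  CollisionFree F μ x →
  F [ μ / x ]ᶠ ⟪ ρ ⟫ᶠ ≡ F ⟪ ρ [ x ↦ μ ⟪ ρ ⟫ ] ⟫ᶠ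
subst-⟪⟫ᶠ (k ≐ l) μ x ρ cf = cong₂ _≐_ (subst-⟪⟫ k μ x ρ) (subst-⟪⟫ l μ x ρ)
subst-⟪⟫ᶠ (atom p ls) μ x ρ cf = cong (λ ks → atom p ks) (subst-⟪⟫ᵛ ls μ x ρ)
subst-⟪⟫ᶠ (neg F) μ x ρ cf = cong neg (subst-⟪⟫ᶠ F μ x ρ cf)
subst-⟪⟫ᶠ (binary c F G) μ x ρ cf =
  cong₂ (binary c) (subst-⟪⟫ᶠ F μ x ρ λ y y∈ → cf y y∈ ∘ inj₁)
                   (subst-⟪⟫ᶠ G μ x ρ λ y y∈ → cf y y∈ ∘ inj₂)
subst-⟪⟫ᶠ (quant q y F) μ x ρ cf with x ≟ y
... | yes refl =
  cong (quant q y) (sym (⟪⟫ᶠ-ext F (update-overwrite ρ x (μ ⟪ ρ ⟫) ⌊ var x ⌋)))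
... | no x≢y = cong (quant q y)
  (trans (subst-⟪⟫ᶠ F μ x ρ′ λ z z∈ fis → cf z z∈ (x≢y , inj₂ fis))
  (trans (⟪⟫ᶠ-cong F agree)
         (sym (⟪⟫ᶠ-ext F (update-swap ρ (μ ⟪ ρ ⟫) ⌊ var y ⌋ x≢y)))))
  where
  ρ′ = ρ [ y ↦ ⌊ var y ⌋ ]
  -- If x is free in F, then y does not occur in μ.
  agree : ∀ {z} → z ∈ free F →
    (ρ′ [ x ↦ μ ⟪ ρ′ ⟫ ]) z ≡ (ρ′ [ x ↦ μ ⟪ ρ ⟫ ]) z
  agree {z} z∈ with x ≟ z
  ... | no _ = refl
  ... | yes refl = ⟪⟫-cong μ λ {w} w∈ →
    update-other ρ y ⌊ var y ⌋ λ { refl → cf y w∈ (x≢y , inj₁ (refl , z∈)) }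

⟪⟫ᵛ-subst : ∀ {n} (ls : Vec (AList A) n) (μ : AList A) (x : Var) (ρ : Env A) →
  (∀ {z} → x ≢ z → x ∉ vars (ρ z)) →
  Vec.map (_[ μ / x ]) (Vec.map (_⟪ ρ [ x ↦ ⌊ var x ⌋ ] ⟫) ls) ≡
  Vec.map (_⟪ ρ [ x ↦ μ ] ⟫) ls
⟪⟫ᵛ-subst [] μ x ρ x∉ρ = refl
⟪⟫ᵛ-subst (l ∷ ls) μ x ρ x∉ρ =
  cong₂ _∷_ (⟪⟫-subst l μ x ρ x∉ρ) (⟪⟫ᵛ-subst ls μ x ρ x∉ρ)

-- Connects the body of a quantified formula under ρ, where x is left alone,
-- with the environments that interpret x by μ.
⟪⟫ᶠ-subst : (F : Formula A P) (μ : AList A) (x : Var) (ρ : Env A) →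
  (∀ {z} → x ≢ z → x ∉ vars (ρ z)) →
  F ⟪ ρ [ x ↦ ⌊ var x ⌋ ] ⟫ᶠ [ μ / x ]ᶠ ≡ F ⟪ ρ [ x ↦ μ ] ⟫ᶠ
⟪⟫ᶠ-subst (k ≐ l) μ x ρ x∉ρ =
  cong₂ _≐_ (⟪⟫-subst k μ x ρ x∉ρ) (⟪⟫-subst l μ x ρ x∉ρ)
⟪⟫ᶠ-subst (atom p ls) μ x ρ x∉ρ =
  cong (λ ks → atom p ks) (⟪⟫ᵛ-subst ls μ x ρ x∉ρ)
⟪⟫ᶠ-subst (neg F) μ x ρ x∉ρ = cong neg (⟪⟫ᶠ-subst F μ x ρ x∉ρ)
⟪⟫ᶠ-subst (binary c F G) μ x ρ x∉ρ =
  cong₂ (binary c) (⟪⟫ᶠ-subst F μ x ρ x∉ρ) (⟪⟫ᶠ-subst G μ x ρ x∉ρ)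
⟪⟫ᶠ-subst (quant q y F) μ x ρ x∉ρ with x ≟ y
... | yes refl = cong (quant q y)
  (trans (⟪⟫ᶠ-ext F (update-overwrite ρ x ⌊ var x ⌋ ⌊ var x ⌋))
         (sym (⟪⟫ᶠ-ext F (update-overwrite ρ x μ ⌊ var x ⌋))))
... | no x≢y = cong (quant q y)
  (trans (cong (_[ μ / x ]ᶠ)
           (⟪⟫ᶠ-ext F (update-swap ρ ⌊ var x ⌋ ⌊ var y ⌋ x≢y)))
  (trans (⟪⟫ᶠ-subst F μ x (ρ [ y ↦ ⌊ var y ⌋ ]) x∉ρ′)
         (sym (⟪⟫ᶠ-ext F (update-swap ρ μ ⌊ var y ⌋ x≢y)))))
  where
  x∉ρ′ : ∀ {z} → x ≢ z → x ∉ vars ((ρ [ y ↦ ⌊ var y ⌋ ]) z)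
  x∉ρ′ {z} x≢z with y ≟ z
  ... | yes _ = λ { (here x≡y) → x≢y x≡y }
  ... | no _ = x∉ρ x≢z

∈-free-⟪⟫ᵛ : ∀ {n} (ls : Vec (AList A) n) (ρ : Env A) {z : Var} →
  z ∈ concatMap vars (toList (Vec.map (_⟪ ρ ⟫) ls)) →
  ∃ λ y → y ∈ concatMap vars (toList ls) × z ∈ vars (ρ y)
∈-free-⟪⟫ᵛ (l ∷ ls) ρ z∈ with ∈-++⁻ (vars (l ⟪ ρ ⟫)) z∈
... | inj₁ z∈l = let y , y∈ , z∈y = ∈-vars-⟪⟫ l ρ z∈l in y , ∈-++⁺ˡ y∈ , z∈y
... | inj₂ z∈ls =
  let y , y∈ , z∈y = ∈-free-⟪⟫ᵛ ls ρ z∈ls in y , ∈-++⁺ʳ (vars l) y∈ , z∈y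

∈-free-⟪⟫ᶠ : (F : Formula A P) (ρ : Env A) {z : Var} → z ∈ free (F ⟪ ρ ⟫ᶠ) →
  ∃ λ y → y ∈ free F × z ∈ vars (ρ y)
∈-free-⟪⟫ᶠ (k ≐ l) ρ z∈ with ∈-++⁻ (vars (k ⟪ ρ ⟫)) z∈
... | inj₁ z∈k = let y , y∈ , z∈y = ∈-vars-⟪⟫ k ρ z∈k in y , ∈-++⁺ˡ y∈ , z∈y
... | inj₂ z∈l =
  let y , y∈ , z∈y = ∈-vars-⟪⟫ l ρ z∈l in y , ∈-++⁺ʳ (vars k) y∈ , z∈y
∈-free-⟪⟫ᶠ (atom p ls) ρ z∈ = ∈-free-⟪⟫ᵛ ls ρ z∈
∈-free-⟪⟫ᶠ (neg F) ρ z∈ = ∈-free-⟪⟫ᶠ F ρ z∈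
∈-free-⟪⟫ᶠ (binary c F G) ρ z∈ with ∈-++⁻ (free (F ⟪ ρ ⟫ᶠ)) z∈
... | inj₁ z∈F = let y , y∈ , z∈y = ∈-free-⟪⟫ᶠ F ρ z∈F in y , ∈-++⁺ˡ y∈ , z∈y
... | inj₂ z∈G =
  let y , y∈ , z∈y = ∈-free-⟪⟫ᶠ G ρ z∈G in y , ∈-++⁺ʳ (free F) y∈ , z∈y
∈-free-⟪⟫ᶠ (quant q x F) ρ z∈
  with ∈-free-quant⁻ (F ⟪ ρ [ x ↦ ⌊ var x ⌋ ] ⟫ᶠ) x {q} z∈
... | z∈F , x≢z with ∈-free-⟪⟫ᶠ F (ρ [ x ↦ ⌊ var x ⌋ ]) z∈F
... | y , y∈ , z∈y with x ≟ y
∈-free-⟪⟫ᶠ (quant q x F) ρ z∈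
  | z∈F , x≢z | y , y∈ , here z≡x | yes _ = ⊥-elim (x≢z (sym z≡x))
... | no x≢y = y , ∈-free-quant⁺ F x {q} y∈ x≢y , z∈y

-- The pairs of σ override ρ; of several pairs with the same variable, the
-- first one counts, as in the successive substitution of closed lists.
override : Env A → List (Var × AList A) → Env A
override ρ [] = ρ
override ρ ((x , μ) ∷ σ) = override ρ σ [ x ↦ μ ]

substs-⟪⟫ᶠ : (F : Formula A P) (σ : List (Var × AList A)) (ρ : Env A) →
  All (λ (_ , μ) → vars μ ≡ []) σ →
  F [ σ ]ᶠ* ⟪ ρ ⟫ᶠ ≡ F ⟪ override ρ σ ⟫ᶠ
substs-⟪⟫ᶠ F [] ρ [] = refl
substs-⟪⟫ᶠ F ((x , μ) ∷ σ) ρ (μ-closed ∷ σ-closed) =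
  trans (substs-⟪⟫ᶠ (F [ μ / x ]ᶠ) σ ρ σ-closed)
  (trans (subst-⟪⟫ᶠ F μ x ρ′ λ _ y∈ → ⊥-elim (closed-∉ μ-closed y∈))
         (cong (λ ν → F ⟪ ρ′ [ x ↦ ν ] ⟫ᶠ) (⟪⟫-closed μ ρ′ μ-closed)))
  where ρ′ = override ρ σ

override-self : (ρ : Env A) (xs : List Var) →
  override ρ (map (λ x → x , ρ x) xs) ≗ ρ
override-self ρ [] z = refl
override-self ρ (x ∷ xs) z with x ≟ z
... | yes refl = refl
... | no _ = override-self ρ xs z

dom-self : (ρ : Env A) (xs : List Var) →
  map proj₁ (map (λ x → x , ρ x) xs) ≡ xs
dom-self ρ [] = refl
dom-self ρ (x ∷ xs) = cong (x ∷_) (dom-self ρ xs)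

-- Provable formulas belong to the system

module _ {A P : Set ℓ} (S : FormalSystem A P) where
  open FormalSystem S

  ⟨⟩ᵖ-formula : ∀ {j} (β : PropFormula j) (Fs : Fin j → Formula A P) →
    (∀ i → IsFormula (Fs i)) → IsFormula (β ⟨ Fs ⟩ᵖ)
  ⟨⟩ᵖ-formula (pvar i) Fs Fs∈ = Fs∈ i
  ⟨⟩ᵖ-formula (pneg β) Fs Fs∈ = ⟨⟩ᵖ-formula β Fs Fs∈
  ⟨⟩ᵖ-formula (pbinary c β γ) Fs Fs∈ =
    ⟨⟩ᵖ-formula β Fs Fs∈ , ⟨⟩ᵖ-formula γ Fs Fs∈

  varArgs-formula : ∀ {n} (xs : Vec Var n) → VecAll.All 𝓛 (varArgs xs)
  varArgs-formula [] = []
  varArgs-formula (x ∷ xs) = X⊆𝓛 x ∷ varArgs-formula xs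

  equalities⇒-formula : ∀ {n} (xs ys : Vec Var n) {F : Formula A P} →
    IsFormula F → IsFormula (equalities⇒ xs ys F)
  equalities⇒-formula [] [] F∈ = F∈
  equalities⇒-formula (x ∷ xs) (y ∷ ys) F∈ =
    (X⊆𝓛 x , X⊆𝓛 y) , equalities⇒-formula xs ys F∈

  provable-formula : ∀ {F} → Provable S F → IsFormula F
  provable-formula (basis F∈B) = B-lists F∈B
  provable-formula (tautology β Fs _ Fs∈) = ⟨⟩ᵖ-formula β Fs Fs∈
  provable-formula (≐-refl x) = X⊆𝓛 x , X⊆𝓛 x
  provable-formula (≐-subst x y l∈ μ∈) =
    (𝓛-subst y l∈ (X⊆𝓛 x) , 𝓛-subst y μ∈ (X⊆𝓛 x)) , (X⊆𝓛 x , X⊆𝓛 y) , l∈ , μ∈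
  provable-formula (≐-atom p xs ys) =
    equalities⇒-formula xs ys (varArgs-formula xs , varArgs-formula ys)
  provable-formula (∀-elim x F∈) = F∈ , F∈
  provable-formula (∀-shift x F∈ G∈ _) = (F∈ , G∈) , F∈ , G∈
  provable-formula (∃-def x F∈) = F∈ , F∈
  provable-formula (detach _ F⇒G) = proj₂ (provable-formula F⇒G)
  provable-formula (substitute {F} x ⊢F l∈ _) =
    ListsIn-subst 𝓛-subst F x (provable-formula ⊢F) l∈
  provable-formula (generalize x ⊢F) = provable-formula ⊢F

-- Substitution of closed lists stays inside the system

  -- Every variable is sent to a closed list of the system.
  Closing : Env A → Set ℓ
  Closing ρ = ∀ z → ClosedList S (ρ z)

  -- What a closing environment becomes below quantifiers: bound variables
  -- stand for themselves.
  PartlyClosing : Env A → Set ℓ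
  PartlyClosing ρ = ∀ z → ρ z ≡ ⌊ var z ⌋ ⊎ ClosedList S (ρ z)

  closing-partly : ∀ {ρ} → Closing ρ → PartlyClosing ρ
  closing-partly ρ∈ z = inj₂ (ρ∈ z)

  update-closing : ∀ {ρ μ} x → Closing ρ → ClosedList S μ →
    Closing (ρ [ x ↦ μ ])
  update-closing x ρ∈ μ∈ z with x ≟ z
  ... | yes _ = μ∈
  ... | no _ = ρ∈ z

  bind-partly : ∀ {ρ} x → PartlyClosing ρ → PartlyClosing (ρ [ x ↦ ⌊ var x ⌋ ])
  bind-partly x ρ∈ z with x ≟ z
  ... | yes refl = inj₁ refl
  ... | no _ = ρ∈ z

  override-closing : ∀ {ρ} (σ : List (Var × AList A)) → Closing ρ →
    All (ClosedList S ∘ proj₂) σ → Closing (override ρ σ)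
  override-closing [] ρ∈ [] = ρ∈
  override-closing ((x , μ) ∷ σ) ρ∈ (μ∈ ∷ σ∈) =
    update-closing x (override-closing σ ρ∈ σ∈) μ∈

  private
    -- Induction on a list xs that contains the variables of l on which ρ is
    -- not the identity. A closed ρ x may be substituted for x beforehand: a
    -- single substitution, which removes x from l and leaves l ⟪ ρ ⟫
    -- unchanged.
    ⟪⟫-in : ∀ (xs : List Var) {l} {ρ} → PartlyClosing ρ → 𝓛 l →
      (∀ {z} → z ∈ vars l → z ∉ xs → ρ z ≡ ⌊ var z ⌋) → 𝓛 (l ⟪ ρ ⟫)
    ⟪⟫-in [] {l} {ρ} ρ∈ l∈ fixed =
      subst 𝓛 (sym (⟪⟫-fixed l ρ λ z∈ → fixed z∈ λ ())) l∈
    ⟪⟫-in (x ∷ xs) {l} {ρ} ρ∈ l∈ fixed with ρ∈ x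
    ... | inj₁ ρx≡x = ⟪⟫-in xs ρ∈ l∈ fixed′
      where
      fixed′ : ∀ {z} → z ∈ vars l → z ∉ xs → ρ z ≡ ⌊ var z ⌋
      fixed′ {z} z∈ z∉ with z ≟ x
      ... | yes refl = ρx≡x
      ... | no z≢x = fixed z∈ λ { (here z≡x) → z≢x z≡x ; (there z∈xs) → z∉ z∈xs }
    ... | inj₂ (ρx∈ , ρx-closed) =
      subst 𝓛 absorb (⟪⟫-in xs {l [ ρ x / x ]} ρ∈ (𝓛-subst x l∈ ρx∈) fixed′)
      where
      absorb : l [ ρ x / x ] ⟪ ρ ⟫ ≡ l ⟪ ρ ⟫
      absorb = trans (subst-⟪⟫ l (ρ x) x ρ)
        (⟪⟫-cong l λ {z} _ →
          trans (cong (λ ν → (ρ [ x ↦ ν ]) z) (⟪⟫-closed (ρ x) ρ ρx-closed))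
                (update-self ρ x z))
      fixed′ : ∀ {z} → z ∈ vars (l [ ρ x / x ]) → z ∉ xs → ρ z ≡ ⌊ var z ⌋
      fixed′ {z} z∈ z∉
        with ∈-vars-⟪⟫ l (idEnv [ x ↦ ρ x ])
               (subst (λ k → z ∈ vars k) (subst-as-⟪⟫ l (ρ x) x) z∈)
      ... | y , y∈ , z∈y with x ≟ y
      ... | yes _ = ⊥-elim (closed-∉ ρx-closed z∈y)
      fixed′ {z} z∈ z∉ | y , y∈ , here refl | no x≢y =
        fixed y∈ λ { (here y≡x) → x≢y (sym y≡x) ; (there y∈xs) → z∉ y∈xs }

  -- The lists of the system are given as closed under single substitutions
  -- only; this is the simultaneous version.
  ⟪⟫-list : ∀ {l ρ} → PartlyClosing ρ → 𝓛 l → 𝓛 (l ⟪ ρ ⟫)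
  ⟪⟫-list {l} ρ∈ l∈ = ⟪⟫-in (vars l) ρ∈ l∈ λ z∈ z∉ → ⊥-elim (z∉ z∈)

  ⟪⟫ᵛ-list : ∀ {n} {ls : Vec (AList A) n} {ρ} → PartlyClosing ρ →
    VecAll.All 𝓛 ls → VecAll.All 𝓛 (Vec.map (_⟪ ρ ⟫) ls)
  ⟪⟫ᵛ-list ρ∈ [] = []
  ⟪⟫ᵛ-list ρ∈ (l∈ ∷ ls∈) = ⟪⟫-list ρ∈ l∈ ∷ ⟪⟫ᵛ-list ρ∈ ls∈

  ⟪⟫ᶠ-formula : ∀ (F : Formula A P) {ρ} → PartlyClosing ρ → IsFormula F →
    IsFormula (F ⟪ ρ ⟫ᶠ)
  ⟪⟫ᶠ-formula (k ≐ l) ρ∈ (k∈ , l∈) = ⟪⟫-list ρ∈ k∈ , ⟪⟫-list ρ∈ l∈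
  ⟪⟫ᶠ-formula (atom p ls) ρ∈ ls∈ = ⟪⟫ᵛ-list ρ∈ ls∈
  ⟪⟫ᶠ-formula (neg F) ρ∈ F∈ = ⟪⟫ᶠ-formula F ρ∈ F∈
  ⟪⟫ᶠ-formula (binary c F G) ρ∈ (F∈ , G∈) =
    ⟪⟫ᶠ-formula F ρ∈ F∈ , ⟪⟫ᶠ-formula G ρ∈ G∈
  ⟪⟫ᶠ-formula (quant q x F) ρ∈ F∈ = ⟪⟫ᶠ-formula F (bind-partly x ρ∈) F∈

  ⟪⟫-closedList : ∀ l {ρ} → Closing ρ → 𝓛 l → ClosedList S (l ⟪ ρ ⟫)
  ⟪⟫-closedList l {ρ} ρ∈ l∈ = ⟪⟫-list (closing-partly ρ∈) l∈ ,
    ⊆-closed λ z∈ → let y , _ , z∈y = ∈-vars-⟪⟫ l ρ z∈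
                    in closed-∉ (proj₂ (ρ∈ y)) z∈y

  ⟪⟫ᶠ-sentence : ∀ F {ρ} → Closing ρ → IsFormula F → Sentence S (F ⟪ ρ ⟫ᶠ)
  ⟪⟫ᶠ-sentence F {ρ} ρ∈ F∈ = ⟪⟫ᶠ-formula F (closing-partly ρ∈) F∈ ,
    ⊆-closed λ z∈ → let y , _ , z∈y = ∈-free-⟪⟫ᶠ F ρ z∈
                    in closed-∉ (proj₂ (ρ∈ y)) z∈y

  bind-vars : ∀ {ρ} x y → Closing ρ →
    vars ((ρ [ x ↦ ⌊ var x ⌋ ]) y) ⊆ x ∷ []
  bind-vars x y ρ∈ z∈ with x ≟ y
  ... | yes _ = z∈
  ... | no _ = ⊥-elim (closed-∉ (proj₂ (ρ∈ y)) z∈)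

  closing-∉ : ∀ {ρ} {x : Var} → Closing ρ → ∀ {z} → x ≢ z → x ∉ vars (ρ z)
  closing-∉ ρ∈ {z} _ = closed-∉ (proj₂ (ρ∈ z))

-- Truth under a closing environment

not-true : {b : Bool} → ¬ b ≡ true → b ≡ false
not-true {true} b≢ = ⊥-elim (b≢ refl)
not-true {false} b≢ = refl

module _ {A P : Set ℓ} (S : FormalSystem A P) (𝓓 : Model S) where
  open Model 𝓓
  open FormalSystem Ŝ using (IsFormula; X⊆𝓛; 𝓛-subst) renaming (𝓛 to 𝓛ˣ)

  private
    Fml : Set ℓ
    Fml = Formula (A ⊎ Name) P

    Environment : Set ℓ
    Environment = Env (A ⊎ Name)

  truth-cong : ∀ {F G} → F ≡ G → .(F∈ : Sentence Ŝ F) .(G∈ : Sentence Ŝ G) →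
    truth F F∈ ≡ truth G G∈
  truth-cong refl _ _ = refl

  ⟦⟧-cong : ∀ {k l} → k ≡ l → .(k∈ : ClosedList Ŝ k) .(l∈ : ClosedList Ŝ l) →
    ⟦ k ⟧ k∈ ≡ ⟦ l ⟧ l∈
  ⟦⟧-cong refl _ _ = refl

  -- The truth value of F under the closing environment ρ.
  truthAt : (F : Fml) (ρ : Environment) → .(IsFormula F) → .(Closing Ŝ ρ) → Bool
  truthAt F ρ F∈ ρ∈ = truth (F ⟪ ρ ⟫ᶠ) (⟪⟫ᶠ-sentence Ŝ F ρ∈ F∈)

  truthAt-cong : ∀ F {ρ τ} .(F∈ : IsFormula F)
    .(ρ∈ : Closing Ŝ ρ) .(τ∈ : Closing Ŝ τ) →
    (∀ {z} → z ∈ free F → ρ z ≡ τ z) →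
    truthAt F ρ F∈ ρ∈ ≡ truthAt F τ F∈ τ∈
  truthAt-cong F F∈ ρ∈ τ∈ ρ≡τ = truth-cong (⟪⟫ᶠ-cong F ρ≡τ) _ _

  module _ {ρ : Environment} (ρ∈ : Closing Ŝ ρ) where

    truthAt-neg : ∀ F (F∈ : IsFormula F) →
      truthAt (neg F) ρ F∈ ρ∈ ≡ not (truthAt F ρ F∈ ρ∈)
    truthAt-neg F F∈ = truth-neg {F ⟪ ρ ⟫ᶠ} (⟪⟫ᶠ-sentence Ŝ F ρ∈ F∈)

    truthAt-binary : ∀ c F G (F∈ : IsFormula F) (G∈ : IsFormula G) →
      truthAt (binary c F G) ρ (F∈ , G∈) ρ∈ ≡
      ⟦ c ⟧ᶜ (truthAt F ρ F∈ ρ∈) (truthAt G ρ G∈ ρ∈)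
    truthAt-binary c F G F∈ G∈ = truth-binary c {F ⟪ ρ ⟫ᶠ} {G ⟪ ρ ⟫ᶠ}
      (⟪⟫ᶠ-sentence Ŝ F ρ∈ F∈) (⟪⟫ᶠ-sentence Ŝ G ρ∈ G∈)

    ⇒-intro : ∀ F G (F∈ : IsFormula F) (G∈ : IsFormula G) →
      (truthAt F ρ F∈ ρ∈ ≡ true → truthAt G ρ G∈ ρ∈ ≡ true) →
      truthAt (F ⇒ G) ρ (F∈ , G∈) ρ∈ ≡ true
    ⇒-intro F G F∈ G∈ f
      rewrite truthAt-binary →′ F G F∈ G∈ with truthAt F ρ F∈ ρ∈
    ... | true = f refl
    ... | false = refl

    ⇒-elim : ∀ F G (F∈ : IsFormula F) (G∈ : IsFormula G) →
      truthAt (F ⇒ G) ρ (F∈ , G∈) ρ∈ ≡ true →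
      truthAt F ρ F∈ ρ∈ ≡ true → truthAt G ρ G∈ ρ∈ ≡ true
    ⇒-elim F G F∈ G∈ F⇒G F-true
      rewrite truthAt-binary →′ F G F∈ G∈ | F-true = F⇒G

    ≐-intro : ∀ k l (k∈ : 𝓛ˣ k) (l∈ : 𝓛ˣ l) →
      ⟦ k ⟪ ρ ⟫ ⟧ (⟪⟫-closedList Ŝ k ρ∈ k∈) ≡
      ⟦ l ⟪ ρ ⟫ ⟧ (⟪⟫-closedList Ŝ l ρ∈ l∈) →
      truthAt (k ≐ l) ρ (k∈ , l∈) ρ∈ ≡ true
    ≐-intro k l k∈ l∈ = Equivalence.from
      (truth-≐ (⟪⟫-closedList Ŝ k ρ∈ k∈) (⟪⟫-closedList Ŝ l ρ∈ l∈))

    ≐-elim : ∀ k l (k∈ : 𝓛ˣ k) (l∈ : 𝓛ˣ l) →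
      truthAt (k ≐ l) ρ (k∈ , l∈) ρ∈ ≡ true →
      ⟦ k ⟪ ρ ⟫ ⟧ (⟪⟫-closedList Ŝ k ρ∈ k∈) ≡
      ⟦ l ⟪ ρ ⟫ ⟧ (⟪⟫-closedList Ŝ l ρ∈ l∈)
    ≐-elim k l k∈ l∈ = Equivalence.to
      (truth-≐ (⟪⟫-closedList Ŝ k ρ∈ k∈) (⟪⟫-closedList Ŝ l ρ∈ l∈))

    module _ (x : Var) (F : Fml) (F∈ : IsFormula F) where
      private
        -- The formula below the quantifier in (quant q x F) ⟪ ρ ⟫ᶠ.
        body : Fml
        body = F ⟪ ρ [ x ↦ ⌊ var x ⌋ ] ⟫ᶠ

        body∈ : IsFormula body
        body∈ = ⟪⟫ᶠ-formula Ŝ F (bind-partly Ŝ x (closing-partly Ŝ ρ∈)) F∈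

        body⊆x : free body ⊆ x ∷ []
        body⊆x z∈ =
          let y , _ , z∈y = ∈-free-⟪⟫ᶠ F (ρ [ x ↦ ⌊ var x ⌋ ]) z∈
          in bind-vars Ŝ x y ρ∈ z∈y

        instance-truth : ∀ l (l∈ : ClosedList Ŝ l) →
          truth (body [ l / x ]ᶠ) (instance-sentence Ŝ x body body∈ body⊆x l∈) ≡
          truthAt F (ρ [ x ↦ l ]) F∈ (update-closing Ŝ x ρ∈ l∈)
        instance-truth l l∈ =
          truth-cong (⟪⟫ᶠ-subst F l x ρ (closing-∉ Ŝ ρ∈)) _ _

      ∀-intro :
        (∀ l (l∈ : ClosedList Ŝ l) →
          truthAt F (ρ [ x ↦ l ]) F∈ (update-closing Ŝ x ρ∈ l∈) ≡ true) →
        truthAt (all x F) ρ F∈ ρ∈ ≡ true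
      ∀-intro f = Equivalence.from (truth-∀ x body body∈ body⊆x)
        λ l l∈ → trans (instance-truth l l∈) (f l l∈)

      ∀-inst : truthAt (all x F) ρ F∈ ρ∈ ≡ true →
        ∀ l (l∈ : ClosedList Ŝ l) →
        truthAt F (ρ [ x ↦ l ]) F∈ (update-closing Ŝ x ρ∈ l∈) ≡ true
      ∀-inst t l l∈ = trans (sym (instance-truth l l∈))
        (Equivalence.to (truth-∀ x body body∈ body⊆x) t l l∈)

      ∃-intro : ∀ l (l∈ : ClosedList Ŝ l) →
        truthAt F (ρ [ x ↦ l ]) F∈ (update-closing Ŝ x ρ∈ l∈) ≡ true →
        truthAt (ex x F) ρ F∈ ρ∈ ≡ true
      ∃-intro l l∈ t = Equivalence.from (truth-∃ x body body∈ body⊆x)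
        (l , l∈ , trans (instance-truth l l∈) t)

      ∃-witness : truthAt (ex x F) ρ F∈ ρ∈ ≡ true →
        ∃ λ l → Σ (ClosedList Ŝ l) λ l∈ →
          truthAt F (ρ [ x ↦ l ]) F∈ (update-closing Ŝ x ρ∈ l∈) ≡ true
      ∃-witness t =
        let l , l∈ , u = Equivalence.to (truth-∃ x body body∈ body⊆x) t
        in l , l∈ , trans (sym (instance-truth l l∈)) u

  -- The case distinction is on the truth value of ex x F, a Boolean; nothing
  -- has to be decided about the instances of F.
  truthAt-∃ : ∀ {ρ} (ρ∈ : Closing Ŝ ρ) x F (F∈ : IsFormula F) →
    truthAt (ex x F) ρ F∈ ρ∈ ≡ truthAt (neg (all x (neg F))) ρ F∈ ρ∈
  truthAt-∃ {ρ} ρ∈ x F F∈ =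
    trans (≡-not if-true if-false) (sym (truthAt-neg ρ∈ (all x (neg F)) F∈))
    where
    ≡-not : ∀ {a b} → (a ≡ true → ¬ b ≡ true) → (a ≡ false → b ≡ true) →
      a ≡ not b
    ≡-not {true} t f rewrite not-true (t refl) = refl
    ≡-not {false} t f rewrite f refl = refl
    if-true : truthAt (ex x F) ρ F∈ ρ∈ ≡ true →
      ¬ truthAt (all x (neg F)) ρ F∈ ρ∈ ≡ true
    if-true ∃F ∀¬F with ∃-witness ρ∈ x F F∈ ∃F
    ... | l , l∈ , Fl with ∀-inst ρ∈ x (neg F) F∈ ∀¬F l l∈
    ... | ¬Fl rewrite truthAt-neg (update-closing Ŝ x ρ∈ l∈) F F∈ | Fl
      with () ← ¬Fl
    if-false : truthAt (ex x F) ρ F∈ ρ∈ ≡ false →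
      truthAt (all x (neg F)) ρ F∈ ρ∈ ≡ true
    if-false ¬∃F = ∀-intro ρ∈ x (neg F) F∈ λ l l∈ →
      trans (truthAt-neg (update-closing Ŝ x ρ∈ l∈) F F∈)
        (cong not (not-true λ Fl →
          true≢false (trans (sym (∃-intro ρ∈ x F F∈ l l∈ Fl)) ¬∃F)))
      where
      true≢false : ¬ true ≡ false
      true≢false ()

  truthAt-⟨⟩ᵖ : ∀ {ρ} (ρ∈ : Closing Ŝ ρ) {j} (β : PropFormula j)
    (Fs : Fin j → Fml) (Fs∈ : ∀ i → IsFormula (Fs i)) →
    truthAt (β ⟨ Fs ⟩ᵖ) ρ (⟨⟩ᵖ-formula Ŝ β Fs Fs∈) ρ∈ ≡
    ⟦ β ⟧ᵖ (λ i → truthAt (Fs i) ρ (Fs∈ i) ρ∈)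
  truthAt-⟨⟩ᵖ ρ∈ (pvar i) Fs Fs∈ = refl
  truthAt-⟨⟩ᵖ ρ∈ (pneg β) Fs Fs∈ =
    trans (truthAt-neg ρ∈ (β ⟨ Fs ⟩ᵖ) (⟨⟩ᵖ-formula Ŝ β Fs Fs∈))
          (cong not (truthAt-⟨⟩ᵖ ρ∈ β Fs Fs∈))
  truthAt-⟨⟩ᵖ ρ∈ (pbinary c β γ) Fs Fs∈ =
    trans (truthAt-binary ρ∈ c (β ⟨ Fs ⟩ᵖ) (γ ⟨ Fs ⟩ᵖ)
            (⟨⟩ᵖ-formula Ŝ β Fs Fs∈) (⟨⟩ᵖ-formula Ŝ γ Fs Fs∈))
          (cong₂ ⟦ c ⟧ᶜ (truthAt-⟨⟩ᵖ ρ∈ β Fs Fs∈) (truthAt-⟨⟩ᵖ ρ∈ γ Fs Fs∈))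

  -- The value of l under ρ depends on ρ x only through the value of ρ x: in
  -- the list k obtained by substituting for all variables but x, a closed
  -- list put for x can be exchanged for the name of its value.
  ⟦⟧-update : ∀ {ρ} (ρ∈ : Closing Ŝ ρ) x l (l∈ : 𝓛ˣ l) {μ ν}
    (μ∈ : ClosedList Ŝ μ) (ν∈ : ClosedList Ŝ ν) → ⟦ μ ⟧ μ∈ ≡ ⟦ ν ⟧ ν∈ →
    ⟦ l ⟪ ρ [ x ↦ μ ] ⟫ ⟧
      (⟪⟫-closedList Ŝ l (update-closing Ŝ x ρ∈ μ∈) l∈) ≡
    ⟦ l ⟪ ρ [ x ↦ ν ] ⟫ ⟧
      (⟪⟫-closedList Ŝ l (update-closing Ŝ x ρ∈ ν∈) l∈)
  ⟦⟧-update {ρ} ρ∈ x l l∈ μ∈ ν∈ μ≡ν =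
    trans (via-name μ∈)
      (trans (⟦⟧-cong (cong (λ d → k [ α d / x ]) μ≡ν)
               (instance-list Ŝ k x k∈ k⊆x (α-closed (⟦ _ ⟧ μ∈)))
               (instance-list Ŝ k x k∈ k⊆x (α-closed (⟦ _ ⟧ ν∈))))
             (sym (via-name ν∈)))
    where
    k : AList (A ⊎ Name)
    k = l ⟪ ρ [ x ↦ ⌊ var x ⌋ ] ⟫
    k∈ : 𝓛ˣ k
    k∈ = ⟪⟫-list Ŝ (bind-partly Ŝ x (closing-partly Ŝ ρ∈)) l∈
    k⊆x : vars k ⊆ x ∷ []
    k⊆x z∈ = let y , _ , z∈y = ∈-vars-⟪⟫ l (ρ [ x ↦ ⌊ var x ⌋ ]) z∈
             in bind-vars Ŝ x y ρ∈ z∈y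
    via-name : ∀ {μ} (μ∈ : ClosedList Ŝ μ) →
      ⟦ l ⟪ ρ [ x ↦ μ ] ⟫ ⟧
        (⟪⟫-closedList Ŝ l (update-closing Ŝ x ρ∈ μ∈) l∈) ≡
      ⟦ k [ α (⟦ μ ⟧ μ∈) / x ] ⟧
        (instance-list Ŝ k x k∈ k⊆x (α-closed (⟦ μ ⟧ μ∈)))
    via-name {μ} μ∈ =
      trans (⟦⟧-cong (sym (⟪⟫-subst l μ x ρ (closing-∉ Ŝ ρ∈)))
              (⟪⟫-closedList Ŝ l (update-closing Ŝ x ρ∈ μ∈) l∈)
              (instance-list Ŝ k x k∈ k⊆x μ∈))
            (⟦⟧-subst x k μ k∈ k⊆x μ∈)

  -- The list ρ x is substituted for y in place of ρ y, which has the same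
  -- value.
  subst-value : ∀ {ρ} (ρ∈ : Closing Ŝ ρ) x y l (l∈ : 𝓛ˣ l) →
    ⟦ ρ x ⟧ (ρ∈ x) ≡ ⟦ ρ y ⟧ (ρ∈ y) →
    ⟦ l [ ⌊ var x ⌋ / y ] ⟪ ρ ⟫ ⟧
      (⟪⟫-closedList Ŝ (l [ ⌊ var x ⌋ / y ]) ρ∈ (𝓛-subst y l∈ (X⊆𝓛 x))) ≡
    ⟦ l ⟪ ρ ⟫ ⟧ (⟪⟫-closedList Ŝ l ρ∈ l∈)
  subst-value {ρ} ρ∈ x y l l∈ x≡y =
    trans (⟦⟧-cong (subst-⟪⟫ l ⌊ var x ⌋ y ρ) _ _)
    (trans (⟦⟧-update ρ∈ y l l∈ (ρ∈ x) (ρ∈ y) x≡y)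
           (⟦⟧-cong (⟪⟫-cong l λ {z} _ → update-self ρ y z) _ _))

  -- Under ρ, each variable of the first vector has the same value as the
  -- corresponding one of the second.
  EqualValues : ∀ {ρ n} → Closing Ŝ ρ → Vec Var n → Vec Var n → Set ℓ
  EqualValues {ρ} ρ∈ =
    Pointwise (λ x y → ⟦ ρ x ⟧ (ρ∈ x) ≡ ⟦ ρ y ⟧ (ρ∈ y))

  equalities⇒-intro : ∀ {ρ} (ρ∈ : Closing Ŝ ρ) {n} (xs ys : Vec Var n) F
    (F∈ : IsFormula F) →
    (EqualValues ρ∈ xs ys → truthAt F ρ F∈ ρ∈ ≡ true) →
    truthAt (equalities⇒ xs ys F) ρ (equalities⇒-formula Ŝ xs ys F∈) ρ∈ ≡ true
  equalities⇒-intro ρ∈ [] [] F F∈ f = f []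
  equalities⇒-intro ρ∈ (x ∷ xs) (y ∷ ys) F F∈ f =
    ⇒-intro ρ∈ (⌊ var x ⌋ ≐ ⌊ var y ⌋) (equalities⇒ xs ys F)
      (X⊆𝓛 x , X⊆𝓛 y) (equalities⇒-formula Ŝ xs ys F∈) λ x≐y →
      equalities⇒-intro ρ∈ xs ys F F∈
        (f ∘ (≐-elim ρ∈ ⌊ var x ⌋ ⌊ var y ⌋ (X⊆𝓛 x) (X⊆𝓛 y) x≐y ∷_))

  private
    args-closed : ∀ {ρ} → Closing Ŝ ρ → ∀ {n} (xs : Vec Var n) →
      VecAll.All (ClosedList Ŝ) (Vec.map (_⟪ ρ ⟫) (varArgs xs))
    args-closed ρ∈ [] = []
    args-closed ρ∈ (x ∷ xs) = ρ∈ x ∷ args-closed ρ∈ xs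

    args-value : ∀ {ρ} → Closing Ŝ ρ → ∀ {n} → Vec Var n → Vec Individual n
    args-value ρ∈ xs = VecAll.reduce (λ {l} l∈ → ⟦ l ⟧ l∈) (args-closed ρ∈ xs)

    args-value-cong : ∀ {ρ} (ρ∈ : Closing Ŝ ρ) {n} {xs ys : Vec Var n} →
      EqualValues ρ∈ xs ys → args-value ρ∈ xs ≡ args-value ρ∈ ys
    args-value-cong ρ∈ [] = refl
    args-value-cong ρ∈ (x≡y ∷ xs≡ys) =
      cong₂ _∷_ x≡y (args-value-cong ρ∈ xs≡ys)

  truthAt-varAtom : ∀ {ρ} (ρ∈ : Closing Ŝ ρ) p {n} {xs ys : Vec Var n} →
    EqualValues ρ∈ xs ys →
    truthAt (atom p (varArgs xs)) ρ (varArgs-formula Ŝ xs) ρ∈ ≡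
    truthAt (atom p (varArgs ys)) ρ (varArgs-formula Ŝ ys) ρ∈
  truthAt-varAtom ρ∈ p {n} {xs} {ys} xs≡ys =
    trans (truth-atom p (args-closed ρ∈ xs))
    (trans (cong (predicate p n) (args-value-cong ρ∈ xs≡ys))
           (sym (truth-atom p (args-closed ρ∈ ys))))

-- Validity as truth under all closing environments

  -- Validity is used for the pairs (x , ρ x) with x in free F.
  valid⇒true : ∀ F (F∈ : IsFormula F) → Valid F F∈ →
    ∀ {ρ} (ρ∈ : Closing Ŝ ρ) → truthAt F ρ F∈ ρ∈ ≡ true
  valid⇒true F F∈ valid {ρ} ρ∈ =
    trans (truth-cong eq _ σF∈) (valid σ F⊆σ σ⊆F (σ-closed (free F)))
    where
    σ : List (Var × AList (A ⊎ Name))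
    σ = map (λ x → x , ρ x) (free F)
    F⊆σ : free F ⊆ map proj₁ σ
    F⊆σ {z} = subst (z ∈_) (sym (dom-self ρ (free F)))
    σ⊆F : map proj₁ σ ⊆ free F
    σ⊆F {z} = subst (z ∈_) (dom-self ρ (free F))
    σ-closed : ∀ xs → All (ClosedList Ŝ ∘ proj₂) (map (λ x → x , ρ x) xs)
    σ-closed [] = []
    σ-closed (x ∷ xs) = ρ∈ x ∷ σ-closed xs
    σF∈ : Sentence Ŝ (F [ σ ]ᶠ*)
    σF∈ = instances-sentence Ŝ F σ F∈ F⊆σ (σ-closed (free F))
    eq : F ⟪ ρ ⟫ᶠ ≡ F [ σ ]ᶠ*
    eq = trans (sym (⟪⟫ᶠ-ext F (override-self ρ (free F))))
      (trans (sym (substs-⟪⟫ᶠ F σ ρ (All.map proj₂ (σ-closed (free F)))))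
             (⟪⟫ᶠ-closed (F [ σ ]ᶠ*) ρ (proj₂ σF∈)))

  true⇒valid : ∀ F (F∈ : IsFormula F) →
    (∀ {ρ} (ρ∈ : Closing Ŝ ρ) → truthAt F ρ F∈ ρ∈ ≡ true) → Valid F F∈
  true⇒valid F F∈ true-at σ F⊆σ _ σ-closed =
    trans (truth-cong eq σF∈ _) (true-at (override-closing Ŝ σ ρ∈ σ-closed))
    where
    -- Any closing environment will do outside the variables of σ.
    ρ : Environment
    ρ _ = α inhabited
    ρ∈ : Closing Ŝ ρ
    ρ∈ _ = α-closed inhabited
    σF∈ : Sentence Ŝ (F [ σ ]ᶠ*)
    σF∈ = instances-sentence Ŝ F σ F∈ F⊆σ σ-closed
    eq : F [ σ ]ᶠ* ≡ F ⟪ override ρ σ ⟫ᶠ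
    eq = trans (sym (⟪⟫ᶠ-closed (F [ σ ]ᶠ*) ρ (proj₂ σF∈)))
               (substs-⟪⟫ᶠ F σ ρ (All.map proj₂ σ-closed))

-- Soundness

  sound : ∀ {F} (⊢F : Provable Ŝ F) {ρ} (ρ∈ : Closing Ŝ ρ) →
    truthAt F ρ (provable-formula Ŝ ⊢F) ρ∈ ≡ true
  sound (basis (G , G∈B , refl)) ρ∈ =
    valid⇒true (embedᶠ inj₁ G)
      (embed-formula S Name G (FormalSystem.B-lists S G∈B)) (basis-valid G∈B) ρ∈
  sound (tautology β Fs taut Fs∈) ρ∈ =
    trans (truthAt-⟨⟩ᵖ ρ∈ β Fs Fs∈) (taut _)
  sound (≐-refl x) ρ∈ = ≐-intro ρ∈ ⌊ var x ⌋ ⌊ var x ⌋ (X⊆𝓛 x) (X⊆𝓛 x) refl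
  sound (≐-subst x y {l} {μ} l∈ μ∈) ρ∈ =
    ⇒-intro ρ∈ ((l ≐ μ) [ ⌊ var x ⌋ / y ]ᶠ) (x≐y ⇒ (l ≐ μ)) lμ′∈ (xy∈ , l∈ , μ∈)
      λ l′≐μ′ → ⇒-intro ρ∈ x≐y (l ≐ μ) xy∈ (l∈ , μ∈) λ x≐y-true →
        let x≡y = ≐-elim ρ∈ ⌊ var x ⌋ ⌊ var y ⌋ (X⊆𝓛 x) (X⊆𝓛 y) x≐y-true
        in ≐-intro ρ∈ l μ l∈ μ∈
             (trans (sym (subst-value ρ∈ x y l l∈ x≡y))
             (trans (≐-elim ρ∈ (l [ ⌊ var x ⌋ / y ]) (μ [ ⌊ var x ⌋ / y ])
                      (proj₁ lμ′∈) (proj₂ lμ′∈) l′≐μ′)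
                    (subst-value ρ∈ x y μ μ∈ x≡y)))
    where
    x≐y : Fml
    x≐y = ⌊ var x ⌋ ≐ ⌊ var y ⌋
    xy∈ : IsFormula x≐y
    xy∈ = X⊆𝓛 x , X⊆𝓛 y
    lμ′∈ : IsFormula ((l ≐ μ) [ ⌊ var x ⌋ / y ]ᶠ)
    lμ′∈ = 𝓛-subst y l∈ (X⊆𝓛 x) , 𝓛-subst y μ∈ (X⊆𝓛 x)
  sound (≐-atom p xs ys) ρ∈ =
    equalities⇒-intro ρ∈ xs ys (atom p (varArgs xs) ⇒ atom p (varArgs ys))
      (varArgs-formula Ŝ xs , varArgs-formula Ŝ ys) λ xs≡ys →
      ⇒-intro ρ∈ (atom p (varArgs xs)) (atom p (varArgs ys))
        (varArgs-formula Ŝ xs) (varArgs-formula Ŝ ys)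
        (trans (sym (truthAt-varAtom ρ∈ p xs≡ys)))
  sound (∀-elim x {F} F∈) {ρ} ρ∈ =
    ⇒-intro ρ∈ (all x F) F F∈ F∈ λ ∀F →
      trans (truthAt-cong F F∈ ρ∈ (update-closing Ŝ x ρ∈ (ρ∈ x))
              λ {z} _ → sym (update-self ρ x z))
            (∀-inst ρ∈ x F F∈ ∀F (ρ x) (ρ∈ x))
  sound (∀-shift x {F} {G} F∈ G∈ x∉F) {ρ} ρ∈ =
    ⇒-intro ρ∈ (all x (F ⇒ G)) (F ⇒ all x G) (F∈ , G∈) (F∈ , G∈) λ ∀F⇒G →
    ⇒-intro ρ∈ F (all x G) F∈ G∈ λ F-true →
    ∀-intro ρ∈ x G G∈ λ l l∈ →
    let ρ′∈ = update-closing Ŝ x ρ∈ l∈ in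
    ⇒-elim ρ′∈ F G F∈ G∈ (∀-inst ρ∈ x (F ⇒ G) (F∈ , G∈) ∀F⇒G l l∈)
      (trans (truthAt-cong F F∈ ρ′∈ ρ∈
               λ z∈ → update-other ρ x l λ { refl → x∉F z∈ })
             F-true)
  sound (∃-def x {F} F∈) {ρ} ρ∈ =
    trans (truthAt-binary ρ∈ ↔′ (neg (all x (neg F))) (ex x F) F∈ F∈)
          (subst (λ b → ⟦ ↔′ ⟧ᶜ (truthAt (neg (all x (neg F))) ρ F∈ ρ∈) b ≡ true)
                 (sym (truthAt-∃ ρ∈ x F F∈))
                 (↔-refl (truthAt (neg (all x (neg F))) ρ F∈ ρ∈)))
    where
    ↔-refl : ∀ b → ⟦ ↔′ ⟧ᶜ b b ≡ true
    ↔-refl true = refl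
    ↔-refl false = refl
  sound (detach {F} {G} ⊢F ⊢F⇒G) ρ∈ =
    ⇒-elim ρ∈ F G (provable-formula Ŝ ⊢F) (proj₂ (provable-formula Ŝ ⊢F⇒G))
      (sound ⊢F⇒G ρ∈) (sound ⊢F ρ∈)
  sound (substitute {F} {l} x ⊢F l∈ cf) {ρ} ρ∈ =
    trans (truth-cong (subst-⟪⟫ᶠ F l x ρ cf) _
            (⟪⟫ᶠ-sentence Ŝ F ρ′∈ (provable-formula Ŝ ⊢F)))
          (sound ⊢F ρ′∈)
    where
    ρ′∈ : Closing Ŝ (ρ [ x ↦ l ⟪ ρ ⟫ ])
    ρ′∈ = update-closing Ŝ x ρ∈ (⟪⟫-closedList Ŝ l ρ∈ l∈)
  sound (generalize {F} x ⊢F) ρ∈ =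
    ∀-intro ρ∈ x F (provable-formula Ŝ ⊢F) λ l l∈ →
      sound ⊢F (update-closing Ŝ x ρ∈ l∈)

lemma3p5 : {ℓ : Level} {A P : Set ℓ} (S : FormalSystem A P) (𝓓 : Model S) →
    (F : Formula (A ⊎ Model.Name 𝓓) P) (F∈ : FormalSystem.IsFormula (Model.Ŝ 𝓓) F) →
    Provable (Model.Ŝ 𝓓) F → Model.Valid 𝓓 F F∈
lemma3p5 S 𝓓 F F∈ ⊢F = true⇒valid S 𝓓 F F∈ (sound S 𝓓 ⊢F)
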